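{- Let $\mathcal B(n,l)$ be the reflection algebra with generating matrix $B(u)=\sum_{p,q}E_{pq}\otimes b_p^q(u)$, and let $\operatorname{sdet}B(u)$ be its Sklyanin determinant. Then $$\operatorname{sdet} B(u)=\sum_{\eta\in I_n}\ \sum_{\sigma\in S(\eta)}\alpha(\sigma,\eta)\, b^{1,\dots,n}_{\sigma(1),\dots,\sigma(n)}(u,\eta),$$ where $$\alpha(\sigma,\eta)=(-1)^{\sigma}\prod_{i:\, i<\eta_i}\frac{1}{2u+2-i-n},$$ $(-1)^\sigma$ is the sign of $\sigma$, and $b^{1,\dots,n}_{\sigma(1),\dots,\sigma(n)}(u,\eta)$ is the corresponding matrix coefficient (with lower indices $p_i=\sigma(i)$ and upper indices $q_i=i$) of the product $B_{\eta_1}(u)B_{\eta_2}(u-1)\cdots B_{\eta_n}(u-n+1)$. This coefficient can be computed by the rule $$b^{1,\dots,n}_{\sigma(1),\dots,\sigma(n)}(u,\eta)=\prod_{k=1}^{n} b_{p(k)}^{q(k)}(u-k+1)$$ (factors ordered from left to right by increasing $k$), where $$p(k)=\begin{cases}\sigma(\eta(k)) & \text{if } k\in G_\eta^-,\\ s_k & \text{otherwise,}\end{cases}\qquad q(k)=\begin{cases}\eta(k) & \text{if } k\in G_\eta^+,\\ s_{\gamma_\eta(k)} & \text{otherwise,}\end{cases}$$ and the Einstein summation convention is used for the indices $s_t$: whenever a repeated index $s_t$ occurs in the product, the monomials are summed over $s_t=1,\dots,n$.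
   Context: Reflection algebra. Let $n=m+l$ with $m,l$ nonnegative integers, and $\varepsilon_i=1$ for $1\le i\le m$, $\varepsilon_i=-1$ for $m<i\le n$. Let $P:v\otimes w\mapsto w\otimes v$ on $\mathbb C^n\otimes\mathbb C^n$ and $R(u)=1-P/u$. The reflection algebra $\mathcal B(n,l)$ is the unital associative algebra over $\mathbb C$ with generators $b_{ij}^{(r)}$ ($i,j=1,\dots,n$, $r=0,1,2,\dots$), $b_{ij}^{(0)}=\delta_{ij}\varepsilon_i$, collected into series $b_i^j(u)=\sum_{r\ge0}b_{ij}^{(r)}u^{ -r}$ and the matrix $B(u)=\sum_{i,j}E_{ij}\otimes b_i^j(u)\in\operatorname{End}\mathbb C^n\otimes\mathcal B(n,l)[[u^{ -1}]]$, subject to the reflection equation $R(u-v)B_1(u)R(u+v)B_2(v)=B_2(v)R(u+v)B_1(u)R(u-v)$ and the unitary condition $B(u)B(-u)=1$. For a matrix $X=(x_{ij})$ over an associative algebra $A$, $X_s=\sum_{i,j}1\otimes\cdots\otimes E_{ij}\otimes\cdots\otimes1\otimes x_{ij}\in\operatorname{End}(\mathbb C^n)^{\otimes k}\otimes A$ with $E_{ij}$ in the $s$-th position; $P_{ij}$ and $R_{ij}(u)$ denote $P$ and $R(u)$ acting on the $i$-th and $j$-th copies of $\mathbb C^n$. Shifted series and rational functions of $u$ are expanded as power series in $u^{ -1}$. Sklyanin determinant. Abbreviate $R_{ij}:=R_{ij}(2u-i-j+2)$, and put $\langle B_1,\dots,B_n\rangle=B_1(u)(R_{12}\cdots R_{1n})B_2(u-1)(R_{23}\cdots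 R_{2n})\cdots B_n(u-n+1)$. Let $A_n(v_1\otimes\cdots\otimes v_n)=\sum_{\sigma\in S_n}(-1)^\sigma v_{\sigma(1)}\otimes\cdots\otimes v_{\sigma(n)}$ (no normalization). It is known that $A_n\langle B_1,\dots,B_n\rangle$ equals $A_n$ times a series in $u^{ -1}$ with coefficients in $\mathcal B(n,l)$; this series is $\operatorname{sdet}B(u)$, i.e. $A_n\langle B_1,\dots,B_n\rangle=\operatorname{sdet}B(u)\,A_n$. Combinatorial data. $I_n\subset\mathbb Z^n$ is the set of $n$-tuples $\eta=(\eta_1,\dots,\eta_n)$ with $i\le\eta_i\le n$ for all $i$. View $\eta$ as a function $\{1,\dots,n\}\to\{1,\dots,n\}$, $\eta(i)=\eta_i$. Let $N_1,\dots,N_K$ be the distinct elements of $\operatorname{Im}(\eta)$, and let $\eta^{ -1}(N_j)=\{a_{j,1}<\cdots<a_{j,m_j}\}$. Let $\Gamma_j=(a_{j,1},\dots,a_{j,m_j})\in S_n$ be the corresponding cycle (sending $a_{j,1}\mapsto a_{j,2}\mapsto\cdots\mapsto a_{j,m_j}\mapsto a_{j,1}$), and $\gamma_\eta=\Gamma_1\cdots\Gamma_K$. Put $G_\eta^-=\{a_{j,1}\}_{j=1}^K$ and $G_\eta^+=\{a_{j,m_j}\}_{j=1}^K$ (minimal and maximal elements of the cycles). $S(\eta)$ is the subgroup of $S_n$ of permutations acting trivially on the complement of $\operatorname{Im}(\eta)$ in $\{1,\dots,n\}$. Matrix coefficients $b_{p_1,\dots,p_n}^{q_1,\dots,q_n}(u,\eta)$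 are defined by $$B_{\eta_1}(u)B_{\eta_2}(u-1)\cdots B_{\eta_n}(u-n+1)=\sum_{p_1,\dots,p_n,\,q_1,\dots,q_n}E_{p_1q_1}\otimes\cdots\otimes E_{p_nq_n}\otimes b_{p_1,\dots,p_n}^{q_1,\dots,q_n}(u,\eta).$$ -}

module Defs where

open import Level using (Level; _⊔_)
open import Algebra.Bundles using (RawRing; Ring)
open import Algebra.Apartness.Bundles using (HeytingField)
import Algebra.Definitions.RawSemiring as RawSemiringDefs
open import Data.Bool.Base using (if_then_else_)
open import Data.Fin.Base as Fin using (Fin; zero; suc; toℕ; splitAt)
open import Data.Fin.Permutation.Components using (transpose)
open import Data.Fin.Properties as Fin using (_≟_; _≤?_; _<?_; all?; any?)
open import Data.List.Base as List
  using (List; []; _∷_; foldr; map; filter; mapMaybe; concatMap; cartesianProduct; allFin; upTo; length; head; last)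
import Data.List.Membership.DecPropositional as DecMembership
open import Data.List.Membership.Propositional using (_∈_)
open import Data.Nat.Base as ℕ using (ℕ; zero; suc; _∸_)
open import Data.Product.Base using (_,_; proj₁; ∃)
open import Data.Sum.Base using ([_,_])
open import Data.Vec.Base as Vec using (Vec; []; _∷_; lookup; tabulate)
import Data.Vec.Properties as Vec
import Data.Vec.Relation.Unary.AllPairs as AllPairs
open import Function.Base using (_∘_; id; const)
open import Relation.Binary.PropositionalEquality.Core using (_≡_)
open import Relation.Nullary.Decidable using (Dec; does; ¬?; _×-dec_; _⊎-dec_; _→-dec_)

private variable
  a c ℓ ℓ₁ ℓ₂ : Level

------------------------------------------------------------------------
-- Words, permutations and the combinatorics of η

-- A word is a multi-index (i₁ , … , iₖ), and also a function Fin k → Fin d.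
Word : ℕ → ℕ → Set
Word d k = Vec (Fin d) k

words : ∀ d k → List (Word d k)
words d zero    = [] ∷ []
words d (suc k) = concatMap (λ i → map (i ∷_) (words d k)) (allFin d)

idʷ : ∀ n → Word n n
idʷ = Vec.allFin

_∘ʷ_ : ∀ {d k j} → Word d k → Word k j → Word d j
v ∘ʷ w = Vec.map (lookup v) w

_≟ʷ_ : ∀ {d k} (v w : Word d k) → Dec (v ≡ w)
_≟ʷ_ = Vec.≡-dec _≟_

_∈?_ : ∀ {n} (i : Fin n) (is : List (Fin n)) → Dec (i ∈ is)
_∈?_ = DecMembership._∈?_ _≟_

-- Indices of the mathematics run from 1, those of Fin from 0.
pos : ∀ {n} → Fin n → ℕ
pos = suc ∘ toℕ

permutations : ∀ n → List (Word n n)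
permutations n = filter (AllPairs.allPairs? (λ i j → ¬? (i ≟ j))) (words n n)

inversions : ∀ {n} → Word n n → ℕ
inversions {n} σ =
  length (filter (λ (i , j) → (i <? j) ×-dec (lookup σ j <? lookup σ i))
                 (cartesianProduct (allFin n) (allFin n)))

I : ∀ n → List (Word n n)
I n = filter (λ η → all? λ i → i ≤? lookup η i) (words n n)

module _ {n : ℕ} (η : Word n n) where

  ∈Im? : ∀ N → Dec (∃ λ i → lookup η i ≡ N)
  ∈Im? N = any? λ i → lookup η i ≟ N

  image : List (Fin n)
  image = filter ∈Im? (allFin n)

  S : List (Word n n)
  S = filter (λ σ → all? λ i → ∈Im? i ⊎-dec (lookup σ i ≟ i)) (permutations n)

  -- the increasing list a₁ < a₂ < … of the elements of η⁻¹(N)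
  fibre : Fin n → List (Fin n)
  fibre N = filter (λ i → lookup η i ≟ N) (allFin n)

  G⁻ G⁺ : List (Fin n)
  G⁻ = mapMaybe (head ∘ fibre) image
  G⁺ = mapMaybe (last ∘ fibre) image

-- The cycle (a₁ , … , aₘ), for distinct a₁ , … , aₘ.
cycle : ∀ {n} → List (Fin n) → Fin n → Fin n
cycle []           = id
cycle {n} (a ∷ as) = step a as
  where
  step : Fin n → List (Fin n) → Fin n → Fin n
  step x []       k = if does (k ≟ x) then a else k
  step x (y ∷ ys) k = if does (k ≟ x) then y else step y ys k

γ : ∀ {n} → Word n n → Fin n → Fin n
γ η = foldr _∘_ id (map (λ N → cycle (fibre η N)) (image η))

-- The ranges of the summation variables in the Einstein convention.  The
-- variable sₜ occurs in the monomial exactly when t ∉ G⁻; for t ∈ G⁻ the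
-- entry at t is a placeholder, pinned to a single value.
assignments : ∀ {n} → Word n n → List (Word n n)
assignments {n} η =
  filter (λ s → all? λ t → (t ∈? G⁻ η) →-dec (lookup s t ≟ t)) (words n n)

------------------------------------------------------------------------
-- Finite sums, ordered products, signs

module BigOps (R : RawRing c ℓ) where
  open RawRing R
  open RawSemiringDefs rawSemiring public using (_^_) renaming (_×_ to _·_)

  ∑ ∏ : {A : Set a} → List A → (A → Carrier) → Carrier
  ∑ xs f = foldr (λ x acc → f x + acc) 0# xs
  ∏ xs f = foldr (λ x acc → f x * acc) 1# xs

  ∑-syntax ∏-syntax : {A : Set a} → List A → (A → Carrier) → Carrier
  ∑-syntax = ∑
  ∏-syntax = ∏

  infixr 5 ∑-syntax ∏-syntax
  syntax ∑-syntax xs (λ x → e) = ∑[ x ∈ xs ] e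
  syntax ∏-syntax xs (λ x → e) = ∏[ x ∈ xs ] e

  sgn : ∀ {n} → Word n n → Carrier
  sgn σ = (- 1#) ^ inversions σ

------------------------------------------------------------------------
-- R[[z]], where z stands for u⁻¹: the coefficient of zʳ is the value at r

PowerSeries : RawRing c ℓ → RawRing c ℓ
PowerSeries R = record
  { Carrier = ℕ → Carrier
  ; _≈_     = λ f g → ∀ r → f r ≈ g r
  ; _+_     = λ f g r → f r + g r
  ; _*_     = λ f g r → ∑[ i ∈ upTo (suc r) ] f i * g (r ∸ i)
  ; -_      = λ f r → - f r
  ; 0#      = λ _ → 0#
  ; 1#      = λ { zero → 1# ; (suc _) → 0# }
  }
  where
  open RawRing R
  open BigOps R

module Series (R : RawRing c ℓ) where
  open RawRing R
  open BigOps R using (_^_; _·_; ∑)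
  private module S = RawRing (PowerSeries R)
  private module SOps = BigOps (PowerSeries R)

  C : Carrier → S.Carrier
  C x zero    = x
  C x (suc _) = 0#

  -- the variable z = u⁻¹
  z : S.Carrier
  z 1 = 1#
  z _ = 0#

  -- 1/(u − x) = Σₜ xᵗ u⁻ᵗ⁻¹
  1/[u-_] : Carrier → S.Carrier
  1/[u- x ] zero    = 0#
  1/[u- x ] (suc t) = x ^ t

  -- f(u − k).  Only r ≤ N contribute to the coefficient of u⁻ᴺ, because
  -- (u − k)⁻ʳ begins with u⁻ʳ.
  shift : ℕ → S.Carrier → S.Carrier
  shift k f N = ∑ (upTo (suc N)) λ r → f r * (1/[u- k · 1# ] SOps.^ r) N

  -- f(−u)
  negate : S.Carrier → S.Carrier
  negate f r = (- 1#) ^ r * f r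

------------------------------------------------------------------------
-- End(Kᵈ)^⊗k ⊗ R, with E_{p₁q₁} ⊗ … ⊗ E_{pₖqₖ} ⊗ x written as the matrix
-- having x in row p and column q

End^⊗ : ℕ → ℕ → RawRing c ℓ → RawRing c ℓ
End^⊗ d k R = record
  { Carrier = Word d k → Word d k → Carrier
  ; _≈_     = λ X Y → ∀ p q → X p q ≈ Y p q
  ; _+_     = λ X Y p q → X p q + Y p q
  ; _*_     = λ X Y p q → ∑[ r ∈ words d k ] X p r * Y r q
  ; -_      = λ X p q → - X p q
  ; 0#      = λ _ _ → 0#
  ; 1#      = λ p q → if does (p ≟ʷ q) then 1# else 0#
  }
  where
  open RawRing R
  open BigOps R

module Tensor (d k : ℕ) (R : RawRing c ℓ) where
  open RawRing R
  open BigOps R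
  private module T = RawRing (End^⊗ d k R)

  infixr 7 _•_
  _•_ : Carrier → T.Carrier → T.Carrier
  (x • X) p q = x * X p q

  -- X ↦ Xₛ
  _at_ : (Fin d → Fin d → Carrier) → Fin k → T.Carrier
  (X at s) p q =
    if does (all? λ t → (t ≟ s) ⊎-dec (lookup p t ≟ lookup q t))
    then X (lookup p s) (lookup q s) else 0#

  P : Fin k → Fin k → T.Carrier
  P i j p q = if does (p ≟ʷ tabulate (lookup q ∘ transpose i j)) then 1# else 0#

  -- v₁ ⊗ … ⊗ vₖ ↦ Σ_σ (−1)^σ v_{σ(1)} ⊗ … ⊗ v_{σ(k)}
  Antisym : T.Carrier
  Antisym p q =
    ∑[ σ ∈ permutations k ] (if does (p ≟ʷ (q ∘ʷ σ)) then sgn σ else 0#)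

------------------------------------------------------------------------
-- The reflection algebra 𝓑(n, l), by generators and relations: terms modulo
-- the least congruence containing the K-algebra laws and the relations.  The
-- base field is any field K of characteristic zero, such as ℂ.

fieldRawRing : HeytingField c ℓ₁ ℓ₂ → RawRing c ℓ₁
fieldRawRing K = record { _≈_ = _≈_ ; _+_ = _+_ ; _*_ = _*_ ; -_ = -_ ; 0# = 0# ; 1# = 1# }
  where open HeytingField K

CharacteristicZero : HeytingField c ℓ₁ ℓ₂ → Set ℓ₂
CharacteristicZero K = ∀ k → (suc k · 1#) # 0#
  where
  open HeytingField K
  open BigOps (fieldRawRing K) using (_·_)

module Reflection (K : HeytingField c ℓ₁ ℓ₂) (char0 : CharacteristicZero K) (m l : ℕ) where

  private module K = HeytingField K

  n : ℕ
  n = m ℕ.+ l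

  data Term : Set c where
    ι         : K.Carrier → Term
    b         : Fin n → Fin n → ℕ → Term
    _+ᵗ_ _*ᵗ_ : Term → Term → Term
    -ᵗ_       : Term → Term

  -- Terms up to syntactic equality: only the operations matter here, for
  -- spelling out the coefficients of the defining relations.
  terms : RawRing c c
  terms = record
    { Carrier = Term ; _≈_ = _≡_ ; _+_ = _+ᵗ_ ; _*_ = _*ᵗ_ ; -_ = -ᵗ_
    ; 0# = ι K.0# ; 1# = ι K.1# }

  ε : Fin n → Term
  ε i = [ const 1# , const (- 1#) ] (splitAt m i)
    where open RawRing terms

  δε : Fin n → Fin n → Term
  δε i j = if does (i ≟ j) then ε i else RawRing.0# terms

  -- The two sides of the reflection equation, over Term[[v⁻¹]][[u⁻¹]] (the
  -- coefficient of u⁻ʳ v⁻ˢ is the value at r, s).  With x = u⁻¹, y = v⁻¹ one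
  -- has
  --   xy (u ∓ v) R(u ∓ v) = (y ∓ x) − xy P,
  -- so the equation is stated multiplied by the central non-zero-divisor
  -- x²y² (u − v)(u + v) = (y − x)(y + x), which clears the denominators.
  module ReflectionEquation where
    Series-v  = PowerSeries terms
    Series-uv = PowerSeries Series-v
    open RawRing Series-uv using () renaming (_+_ to _⊞_; _*_ to _⊠_; -_ to ⊟_)
    open Tensor n 2 Series-uv
    open RawRing (End^⊗ n 2 Series-uv)

    x y : RawRing.Carrier Series-uv
    x = Series.z Series-v
    y = Series.C Series-v (Series.z terms)

    R[u-v] R[u+v] B₁[u] B₂[v] lhs rhs : Carrier
    R[u-v] = (y ⊞ (⊟ x)) • 1# + - ((x ⊠ y) • P zero (suc zero))
    R[u+v] = (y ⊞ x)     • 1# + - ((x ⊠ y) • P zero (suc zero))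
    B₁[u]  = (λ i j r → Series.C terms (b i j r)) at zero
    B₂[v]  = (λ i j → Series.C Series-v (b i j)) at suc zero
    lhs    = R[u-v] * B₁[u] * R[u+v] * B₂[v]
    rhs    = B₂[v] * R[u+v] * B₁[u] * R[u-v]

  -- The entries of B(u) B(−u).
  BB⁻ : Fin n → Fin n → ℕ → Term
  BB⁻ i j = ∑[ k ∈ allFin n ] b i k * Series.negate terms (b k j)
    where
    open RawRing (PowerSeries terms)
    open BigOps (PowerSeries terms)

  δ : Fin n → Fin n → ℕ → Term
  δ i j = if does (i ≟ j) then 1# else 0#
    where open RawRing (PowerSeries terms)

  infix 4 _≈_
  data _≈_ : Term → Term → Set (c ⊔ ℓ₁) where
    ≈-refl  : ∀ {s} → s ≈ s
    ≈-sym   : ∀ {s t} → s ≈ t → t ≈ s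
    ≈-trans : ∀ {s t w} → s ≈ t → t ≈ w → s ≈ w

    +-cong : ∀ {s s′ t t′} → s ≈ s′ → t ≈ t′ → (s +ᵗ t) ≈ (s′ +ᵗ t′)
    *-cong : ∀ {s s′ t t′} → s ≈ s′ → t ≈ t′ → (s *ᵗ t) ≈ (s′ *ᵗ t′)
    -‿cong : ∀ {s s′} → s ≈ s′ → (-ᵗ s) ≈ (-ᵗ s′)
    ι-cong : ∀ {x y} → x K.≈ y → ι x ≈ ι y

    +-assoc     : ∀ s t w → ((s +ᵗ t) +ᵗ w) ≈ (s +ᵗ (t +ᵗ w))
    +-comm      : ∀ s t → (s +ᵗ t) ≈ (t +ᵗ s)
    +-identityˡ : ∀ s → (ι K.0# +ᵗ s) ≈ s
    -‿inverseˡ  : ∀ s → ((-ᵗ s) +ᵗ s) ≈ ι K.0#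
    *-assoc     : ∀ s t w → ((s *ᵗ t) *ᵗ w) ≈ (s *ᵗ (t *ᵗ w))
    *-identityˡ : ∀ s → (ι K.1# *ᵗ s) ≈ s
    distribˡ    : ∀ s t w → (s *ᵗ (t +ᵗ w)) ≈ ((s *ᵗ t) +ᵗ (s *ᵗ w))
    distribʳ    : ∀ s t w → ((t +ᵗ w) *ᵗ s) ≈ ((t *ᵗ s) +ᵗ (w *ᵗ s))

    ι-+       : ∀ x y → ι (x K.+ y) ≈ (ι x +ᵗ ι y)
    ι-*       : ∀ x y → ι (x K.* y) ≈ (ι x *ᵗ ι y)
    ι-central : ∀ x s → (ι x *ᵗ s) ≈ (s *ᵗ ι x)

    b-zero     : ∀ i j → b i j 0 ≈ δε i j
    reflection : ∀ p q r s → ReflectionEquation.lhs p q r s ≈ ReflectionEquation.rhs p q r s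
    unitary    : ∀ i j r → BB⁻ i j r ≈ δ i j r

  𝓑 : Ring c (c ⊔ ℓ₁)
  𝓑 = record
    { Carrier = Term ; _≈_ = _≈_ ; _+_ = _+ᵗ_ ; _*_ = _*ᵗ_ ; -_ = -ᵗ_
    ; 0# = ι K.0# ; 1# = ι K.1#
    ; isRing = record
      { +-isAbelianGroup = record
        { isGroup = record
          { isMonoid = record
            { isSemigroup = record
              { isMagma = record
                { isEquivalence = record { refl = ≈-refl ; sym = ≈-sym ; trans = ≈-trans }
                ; ∙-cong = +-cong }
              ; assoc = +-assoc }
            ; identity = +-identityˡ , λ s → ≈-trans (+-comm s _) (+-identityˡ s) }
          ; inverse = -‿inverseˡ , λ s → ≈-trans (+-comm s _) (-‿inverseˡ s)
          ; ⁻¹-cong = -‿cong }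
        ; comm = +-comm }
      ; *-cong = *-cong
      ; *-assoc = *-assoc
      ; *-identity = *-identityˡ , λ s → ≈-trans (≈-sym (ι-central _ s)) (*-identityˡ s)
      ; distrib = distribˡ , distribʳ } }

  ----------------------------------------------------------------------
  -- The Sklyanin determinant

  𝓑[[u⁻¹]] : RawRing c (c ⊔ ℓ₁)
  𝓑[[u⁻¹]] = PowerSeries (Ring.rawRing 𝓑)

  open Series (Ring.rawRing 𝓑) using (C; 1/[u-_]; shift)
  open Tensor n n 𝓑[[u⁻¹]]
  open RawRing 𝓑[[u⁻¹]] using (1#; _*_) renaming (Carrier to 𝓢; _≈_ to _≋_) public
  open BigOps 𝓑[[u⁻¹]] using (∑; ∏; ∑-syntax; ∏-syntax; sgn) public
  private
    𝓣 = End^⊗ n n 𝓑[[u⁻¹]]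
    module T = RawRing 𝓣
    module TOps = BigOps 𝓣

  ½ : Term
  ½ = ι (proj₁ (K.#⇒invertible (char0 1)))

  -- 1/(2u − k) = ½ · 1/(u − k/2)
  1/[2u-_] : ℕ → 𝓢
  1/[2u- k ] = C ½ * 1/[u- k A.· ½ ]
    where module A = BigOps (Ring.rawRing 𝓑)

  -- B(u − k + 1), where k is counted from 1
  B[_] : Fin n → Fin n → Fin n → 𝓢
  B[ k ] p q = shift (pos k ∸ 1) (b p q)

  R : Fin n → Fin n → T.Carrier
  R i j = T.1# T.+ T.- (1/[2u- pos i ℕ.+ pos j ∸ 2 ] • P i j)

  ⟨B₁,…,Bₙ⟩ : T.Carrier
  ⟨B₁,…,Bₙ⟩ = TOps.∏ (allFin n) λ i →
    (B[ i ] at i) T.* TOps.∏ (filter (i <?_) (allFin n)) (R i)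

  -- This determines s: the entry of Antisym at (1, …, n), (1, …, n) is 1.
  IsSdet : 𝓢 → Set (c ⊔ ℓ₁)
  IsSdet s = (Antisym T.* ⟨B₁,…,Bₙ⟩) T.≈ (s • Antisym)

  ----------------------------------------------------------------------
  -- The ingredients of the formula

  -- (2u + 2 − i − n)⁻¹ = 1/(2u − (i + n − 2))
  α : Word n n → Word n n → 𝓢
  α σ η = sgn σ * (∏[ i ∈ filter (λ i → i <? lookup η i) (allFin n) ] 1/[2u- pos i ℕ.+ n ∸ 2 ])

  coeff : Word n n → Word n n → Word n n → 𝓢
  coeff η p q = (TOps.∏ (allFin n) λ k → B[ k ] at lookup η k) p q

  lower upper : (σ η s : Word n n) → Fin n → Fin n
  lower σ η s k = if does (k ∈? G⁻ η) then lookup σ (lookup η k) else lookup s k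
  upper σ η s k = if does (k ∈? G⁺ η) then lookup η k else lookup s (γ η k)

{-# OPTIONS --safe #-}
module Submission where

-- The entry of A_n⟨B₁,…,B_n⟩ in row and column (1,…,n) is the entry of w⟨B₁,…,B_n⟩,
-- where w is the first row of A_n, i.e. the signature, an alternating row vector.  If a
-- row w is alternating in the tensor slots ≥ k, then w B_k is alternating in the slots
-- > k, on which R_{k,k+1} ⋯ R_{kn} acts as 1 − (2u + 2 − k − n)⁻¹ Σ_{j>k} P_{kj}.  As
-- B_k P_{kj} = P_{kj} B_j and w P_{kj} = −w, multiplying w by the k-th block of the
-- bracket gives
--   w B_k(u−k+1) + (2u + 2 − k − n)⁻¹ Σ_{j>k} w B_j(u−k+1),
-- which is again alternating in the slots > k.  Choosing the summand j = η_k in each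
-- step expands the bracket over I_n.
--
-- For the coefficients, a term of the matrix product Π B_{η_k} is a path, recording the
-- value written in slot η_k by each factor k.  That value is read by the next factor
-- γ_η(k) of the same fibre of η, so paths correspond to the assignments of the sₜ.

open import Defs
open import Level using (Level; _⊔_)
open import Algebra.Apartness.Bundles using (HeytingField)
open import Algebra.Bundles using (RawRing; Ring)
open import Data.Bool.Base using (if_then_else_)
open import Data.Fin.Base as Fin using (Fin; zero; suc; toℕ; punchOut)
open import Data.Fin.Permutation.Components using (transpose)
open import Data.Fin.Properties as Fin
  using (_≟_; _≤?_; _<?_; all?; any?; suc-injective; toℕ-injective; toℕ<n; toℕ-fromℕ<; <⇒≢; <-cmp; injective⇒≤; punchOut-injective)
open import Data.Integer.Base as ℤ using (ℤ; +_)
import Data.Integer.Properties as ℤ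
open import Data.List.Base as List
  using (List; []; _∷_; _++_; foldr; map; filter; mapMaybe; concatMap; cartesianProduct; allFin; tabulate; upTo; applyUpTo; length; head; last)
open import Data.List.Membership.Propositional using (_∈_; _∉_)
open import Data.List.Membership.Propositional.Properties using (∈-allFin; ∈-filter⁺; ∈-filter⁻)
open import Data.List.Properties using (filter-accept; filter-reject)
open import Data.List.Relation.Unary.All as All using ([]; _∷_)
import Data.List.Relation.Unary.AllPairs as AllPairsᴸ
open AllPairsᴸ using (_∷_)
import Data.List.Relation.Unary.AllPairs.Properties as AllPairsᴸ
open import Data.List.Relation.Unary.Any using (here; there)
open import Data.Maybe.Base using (Maybe; just; nothing)
open import Data.Nat.Base as ℕ using (ℕ; zero; suc; _∸_; z≤n; s≤s)
import Data.Nat.Properties as ℕ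
open import Data.Product.Base using (_×_; _,_; proj₁; proj₂; ∃)
open import Data.Sum.Base as Sum using (_⊎_; inj₁; inj₂; [_,_])
open import Data.Unit.Base using (⊤; tt)
open import Data.Vec.Base as Vec using (Vec; []; _∷_; lookup; _[_]≔_)
open import Data.Vec.Properties
  using (∷-injective; lookup∘tabulate; tabulate∘lookup; tabulate-cong; lookup-map; lookup-allFin; lookup∘update; lookup∘update′)
import Data.Vec.Relation.Unary.AllPairs as AllPairs
open import Data.Vec.Relation.Unary.Unique.Propositional using (Unique)
open import Data.Vec.Relation.Unary.Unique.Propositional.Properties using (tabulate⁺; lookup-injective)
open import Function.Base using (_∘_; id; case_of_)
open import Function.Bundles using (mk⇔)
open import Relation.Binary.Definitions using (DecidableEquality; tri<; tri≈; tri>)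
open import Relation.Binary.PropositionalEquality as ≡ using (_≡_; _≢_; cong; cong₂; subst; ≢-sym)
open import Relation.Nullary.Decidable using (Dec; yes; no; does; ¬?; _×-dec_; _⊎-dec_; _→-dec_; does-⇔; dec-true; dec-false)
open import Relation.Nullary.Negation using (¬_; contradiction)
open import Relation.Unary using (Pred; Decidable)

-- The obstacle is to keep the antisymmetry alive along the bracket. For j > k the row w B_j alone
-- is not alternating in the slots > k, since transposing two of them may move j. Only the whole sum
-- over j is, because all j > k carry the same coefficient. Hence the rest of the bracket is
-- expanded against the undivided sum, and the choice of η_k is separated afterwards by linearity.
-- The entries of B do not commute; the only factors that ever have to be moved are the scalars c(N)
-- = 1/(2u - N), which are central. The expansion is therefore stated over a ring with matrices B
-- and a central sequence c subject to c(N+1) = c(N) + c(N) c(N+1), which for 1/(2u - N) is the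
-- resolvent identity. The group S(η) enters through the slots that no η_k hits: they are never
-- acted upon, so a nonzero coefficient has σ(i) = i there. Words with repeated letters are excluded
-- earlier, by the zeros of the signature row.

private variable
  a b c ℓ p q : Level
  A : Set a
  B : Set b
  d k ν : ℕ

-- Finite sums

-- `allFin (suc ν)` unfolds to `zero ∷ tabulate suc`, whose tail is not itself an `allFin`. Moving
-- the tabulated function into the summand restores that shape and makes induction on ν possible.
foldr-tabulate : ∀ {X : Set a} {Y : Set b} (h : X → Y → Y) (e : Y) (g : Fin ν → A) (f : A → X) →
  foldr (λ x → h (f x)) e (List.tabulate g) ≡ foldr (λ i → h (f (g i))) e (allFin ν)
foldr-tabulate {ν = zero}  h e g f = ≡.refl
foldr-tabulate {ν = suc ν} h e g f = cong (h (f (g zero)))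
  (≡.trans (foldr-tabulate h e (g ∘ suc) f) (≡.sym (foldr-tabulate h e suc (f ∘ g))))

module FiniteSums (𝓡 : Ring c ℓ) where
  open Ring 𝓡 hiding (zero)
  open BigOps rawRing
  open import Relation.Binary.Reasoning.Setoid setoid
  open import Algebra.Properties.CommutativeSemigroup +-commutativeSemigroup public using () renaming (interchange to +-interchange)
  open import Algebra.Properties.Ring 𝓡 public using (-0#≈0#; -‿+-comm; -‿distribˡ-*; -‿distribʳ-*; -‿involutive; -1*x≈-x)

  private variable
    P : Set p
    Q : Set q
    x y : Carrier
    xs : List A

  -- Conditions on a summation index are kept inside the terms instead of the list, so that sums can
  -- be interchanged and reindexed freely.
  when : Dec P → Carrier → Carrier
  when d x = if does d then x else 0#

  when-⇔ : (d : Dec P) (e : Dec Q) → (P → Q) → (Q → P) → when d x ≈ when e x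
  when-⇔ {x = x} d e f g = reflexive (cong (if_then x else 0#) (does-⇔ (mk⇔ f g) d e))

  when-cong : (d : Dec P) → (P → x ≈ y) → when d x ≈ when d y
  when-cong (yes p) eq = eq p
  when-cong (no _)  eq = refl

  when-yes : (d : Dec P) → P → when d x ≈ x
  when-yes {x = x} d p = reflexive (cong (if_then x else 0#) (dec-true d p))

  when-no : (d : Dec P) → ¬ P → when d x ≈ 0#
  when-no {x = x} d ¬p = reflexive (cong (if_then x else 0#) (dec-false d ¬p))

  when-× : (d : Dec P) (e : Dec Q) → when d (when e x) ≈ when (d ×-dec e) x
  when-× (yes _) (yes _) = refl
  when-× (yes _) (no _)  = refl
  when-× (no _)  e       = refl

  when-0 : (d : Dec P) → when d 0# ≈ 0#
  when-0 (yes _) = refl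
  when-0 (no _)  = refl

  *-when : (d : Dec P) → x * when d y ≈ when d (x * y)
  *-when (yes _) = refl
  *-when (no _)  = zeroʳ _

  when-* : (d : Dec P) → when d x * y ≈ when d (x * y)
  when-* (yes _) = refl
  when-* (no _)  = zeroˡ _

  when-neg : (d : Dec P) → when d (- x) ≈ - when d x
  when-neg (yes _) = refl
  when-neg (no _)  = sym -0#≈0#

  ∑-cong : ∀ (xs : List A) {f g : A → Carrier} → (∀ x → f x ≈ g x) → ∑ xs f ≈ ∑ xs g
  ∑-cong []       f≈g = refl
  ∑-cong (x ∷ xs) f≈g = +-cong (f≈g x) (∑-cong xs f≈g)

  ∏-cong : ∀ (xs : List A) {f g : A → Carrier} → (∀ x → f x ≈ g x) → ∏ xs f ≈ ∏ xs g
  ∏-cong []       f≈g = refl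
  ∏-cong (x ∷ xs) f≈g = *-cong (f≈g x) (∏-cong xs f≈g)

  ∑-zero : ∀ (xs : List A) {f : A → Carrier} → (∀ x → f x ≈ 0#) → ∑ xs f ≈ 0#
  ∑-zero []       f≈0 = refl
  ∑-zero (x ∷ xs) f≈0 = trans (+-cong (f≈0 x) (∑-zero xs f≈0)) (+-identityˡ 0#)

  ∑-+ : ∀ (xs : List A) (f g : A → Carrier) → ∑ xs (λ x → f x + g x) ≈ ∑ xs f + ∑ xs g
  ∑-+ []       f g = sym (+-identityˡ 0#)
  ∑-+ (x ∷ xs) f g = trans (+-congˡ (∑-+ xs f g)) (+-interchange _ _ _ _)

  ∑-neg : ∀ (xs : List A) (f : A → Carrier) → ∑ xs (λ x → - f x) ≈ - ∑ xs f
  ∑-neg []       f = sym -0#≈0#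
  ∑-neg (x ∷ xs) f = trans (+-congˡ (∑-neg xs f)) (-‿+-comm _ _)

  *-∑ : ∀ (xs : List A) (f : A → Carrier) y → y * ∑ xs f ≈ ∑ xs (λ x → y * f x)
  *-∑ []       f y = zeroʳ y
  *-∑ (x ∷ xs) f y = trans (distribˡ y _ _) (+-congˡ (*-∑ xs f y))

  ∑-* : ∀ (xs : List A) (f : A → Carrier) y → ∑ xs f * y ≈ ∑ xs (λ x → f x * y)
  ∑-* []       f y = zeroˡ y
  ∑-* (x ∷ xs) f y = trans (distribʳ y _ _) (+-congˡ (∑-* xs f y))

  ∑-when : ∀ (xs : List A) (f : A → Carrier) (d : Dec P) →
           ∑ xs (λ x → when d (f x)) ≈ when d (∑ xs f)
  ∑-when xs f (yes _) = refl
  ∑-when xs f (no _)  = ∑-zero xs λ _ → refl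

  ∑-swap : ∀ (xs : List A) (ys : List B) (f : A → B → Carrier) →
           ∑ xs (λ x → ∑ ys (f x)) ≈ ∑ ys (λ y → ∑ xs (λ x → f x y))
  ∑-swap []       ys f = sym (∑-zero ys λ _ → refl)
  ∑-swap (x ∷ xs) ys f = trans (+-congˡ (∑-swap xs ys f)) (sym (∑-+ ys _ _))

  ∑-++ : ∀ (xs ys : List A) (f : A → Carrier) → ∑ (xs ++ ys) f ≈ ∑ xs f + ∑ ys f
  ∑-++ []       ys f = sym (+-identityˡ _)
  ∑-++ (x ∷ xs) ys f = trans (+-congˡ (∑-++ xs ys f)) (sym (+-assoc _ _ _))

  ∑-map : ∀ (xs : List A) (g : A → B) (f : B → Carrier) → ∑ (map g xs) f ≈ ∑ xs (f ∘ g)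
  ∑-map []       g f = refl
  ∑-map (x ∷ xs) g f = +-congˡ (∑-map xs g f)

  ∑-concatMap : ∀ (xs : List A) (g : A → List B) (f : B → Carrier) →
                ∑ (concatMap g xs) f ≈ ∑ xs (λ x → ∑ (g x) f)
  ∑-concatMap []       g f = refl
  ∑-concatMap (x ∷ xs) g f = trans (∑-++ (g x) _ f) (+-congˡ (∑-concatMap xs g f))

  ∑-cartesianProduct : ∀ (xs : List A) (ys : List B) (f : A × B → Carrier) →
    ∑ (cartesianProduct xs ys) f ≈ ∑ xs (λ x → ∑ ys (λ y → f (x , y)))
  ∑-cartesianProduct []       ys f = refl
  ∑-cartesianProduct (x ∷ xs) ys f =
    trans (∑-++ (map (x ,_) ys) _ f) (+-cong (∑-map ys _ f) (∑-cartesianProduct xs ys f))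

  ∑-filter : ∀ {P : Pred A p} (P? : Decidable P) (xs : List A) (f : A → Carrier) →
             ∑ (filter P? xs) f ≈ ∑ xs (λ x → when (P? x) (f x))
  ∑-filter P? []       f = refl
  ∑-filter P? (x ∷ xs) f with P? x
  ... | yes _ = +-congˡ (∑-filter P? xs f)
  ... | no _  = trans (∑-filter P? xs f) (sym (+-identityˡ _))

  ∏-filter : ∀ {P : Pred A p} (P? : Decidable P) (xs : List A) (f : A → Carrier) →
             ∏ (filter P? xs) f ≈ ∏ xs (λ x → if does (P? x) then f x else 1#)
  ∏-filter P? []       f = refl
  ∏-filter P? (x ∷ xs) f with P? x
  ... | yes _ = *-congˡ (∏-filter P? xs f)
  ... | no _  = trans (∏-filter P? xs f) (sym (*-identityˡ _))

  ∑-allFin : ∀ (f : Fin (suc ν) → Carrier) → ∑ (allFin (suc ν)) f ≈ f zero + ∑ (allFin ν) (f ∘ suc)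
  ∑-allFin f = +-congˡ (reflexive (foldr-tabulate _+_ 0# suc f))

  ∏-allFin : ∀ (f : Fin (suc ν) → Carrier) → ∏ (allFin (suc ν)) f ≈ f zero * ∏ (allFin ν) (f ∘ suc)
  ∏-allFin f = *-congˡ (reflexive (foldr-tabulate _*_ 1# suc f))

  ∑-words : ∀ d k (f : Word d (suc k) → Carrier) →
            ∑ (words d (suc k)) f ≈ ∑ (allFin d) (λ i → ∑ (words d k) (λ w → f (i ∷ w)))
  ∑-words d k f = trans (∑-concatMap (allFin d) _ f) (∑-cong (allFin d) λ i → ∑-map (words d k) _ f)

  -- Each element of A occurs exactly once in xs, as seen by sums in 𝓡.
  record Enumerates {A : Set a} (_≟A_ : DecidableEquality A) (xs : List A) : Set (a ⊔ c ⊔ ℓ) where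
    constructor enumerates
    field ∑-δ : ∀ (f : A → Carrier) v → ∑ xs (λ x → when (x ≟A v) (f x)) ≈ f v
  open Enumerates

  ∑-δ-allFin : ∀ ν (f : Fin ν → Carrier) v → ∑ (allFin ν) (λ i → when (i ≟ v) (f i)) ≈ f v
  ∑-δ-allFin (suc ν) f zero = begin
    _ ≈⟨ ∑-allFin (λ i → when (i ≟ zero) (f i)) ⟩
    f zero + ∑ (allFin ν) (λ _ → 0#) ≈⟨ +-congˡ (∑-zero (allFin ν) λ _ → refl) ⟩
    f zero + 0# ≈⟨ +-identityʳ _ ⟩
    f zero ∎
  ∑-δ-allFin (suc ν) f (suc v) = begin
    _ ≈⟨ ∑-allFin (λ i → when (i ≟ suc v) (f i)) ⟩
    0# + ∑ (allFin ν) (λ i → when (suc i ≟ suc v) (f (suc i))) ≈⟨ +-identityˡ _ ⟩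
    _ ≈⟨ ∑-cong (allFin ν) (λ i → when-⇔ (suc i ≟ suc v) (i ≟ v) suc-injective (cong suc)) ⟩
    _ ≈⟨ ∑-δ-allFin ν (f ∘ suc) v ⟩
    f (suc v) ∎

  enumerates-allFin : ∀ ν → Enumerates _≟_ (allFin ν)
  enumerates-allFin ν = enumerates (∑-δ-allFin ν)

  ∑-δ-words : ∀ d k (f : Word d k → Carrier) v → ∑ (words d k) (λ w → when (w ≟ʷ v) (f w)) ≈ f v
  ∑-δ-words d zero    f []      = +-identityʳ _
  ∑-δ-words d (suc k) f (v ∷ vs) = begin
    _ ≈⟨ ∑-words d k _ ⟩
    _ ≈⟨ ∑-cong (allFin d) (λ i → ∑-cong (words d k) λ w → trans
           (when-⇔ ((i ∷ w) ≟ʷ (v ∷ vs)) ((i ≟ v) ×-dec (w ≟ʷ vs)) ∷-injective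
             λ (e , e′) → cong₂ _∷_ e e′)
           (sym (when-× (i ≟ v) (w ≟ʷ vs)))) ⟩
    _ ≈⟨ ∑-cong (allFin d) (λ i → ∑-when (words d k) _ (i ≟ v)) ⟩
    _ ≈⟨ ∑-δ-allFin d _ v ⟩
    _ ≈⟨ ∑-δ-words d k _ vs ⟩
    f (v ∷ vs) ∎

  enumerates-words : ∀ d k → Enumerates _≟ʷ_ (words d k)
  enumerates-words d k = enumerates (∑-δ-words d k)

  -- Both sides equal one double sum over pairs (x , y): "P x and y = φ x" and "Q y and x = ψ y"
  -- describe the same pairs. The maps need to be mutually inverse only on P and Q.
  reindex : ∀ {_≟A_ : DecidableEquality A} {_≟B_ : DecidableEquality B} {xs ys} →
    Enumerates _≟A_ xs → Enumerates _≟B_ ys →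
    ∀ {P : Pred A p} {Q : Pred B q} (P? : Decidable P) (Q? : Decidable Q) (φ : A → B) (ψ : B → A) →
    (∀ x → P x → Q (φ x) × x ≡ ψ (φ x)) → (∀ y → Q y → P (ψ y) × y ≡ φ (ψ y)) →
    (f : B → Carrier) →
    ∑ xs (λ x → when (P? x) (f (φ x))) ≈ ∑ ys (λ y → when (Q? y) (f y))
  reindex {_≟A_ = _≟A_} {_≟B_} {xs} {ys} δA δB P? Q? φ ψ to from f = begin
    ∑ xs (λ x → when (P? x) (f (φ x)))
      ≈⟨ ∑-cong xs (λ x → ∑-δ δB (λ y → when (P? x) (f y)) (φ x)) ⟨
    ∑ xs (λ x → ∑ ys (λ y → when (y ≟B φ x) (when (P? x) (f y))))
      ≈⟨ ∑-cong xs (λ x → ∑-cong ys λ y → exchange x y) ⟩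
    ∑ xs (λ x → ∑ ys (λ y → when (x ≟A ψ y) (when (Q? y) (f y))))
      ≈⟨ ∑-swap xs ys _ ⟩
    ∑ ys (λ y → ∑ xs (λ x → when (x ≟A ψ y) (when (Q? y) (f y))))
      ≈⟨ ∑-cong ys (λ y → ∑-δ δA (λ _ → when (Q? y) (f y)) (ψ y)) ⟩
    ∑ ys (λ y → when (Q? y) (f y)) ∎
    where
    exchange : ∀ x y → when (y ≟B φ x) (when (P? x) (f y)) ≈ when (x ≟A ψ y) (when (Q? y) (f y))
    exchange x y = begin
      _ ≈⟨ when-× (y ≟B φ x) (P? x) ⟩
      _ ≈⟨ when-⇔ ((y ≟B φ x) ×-dec P? x) ((x ≟A ψ y) ×-dec Q? y) (λ { (≡.refl , px) → proj₂ (to x px) , proj₁ (to x px) })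
                      (λ { (≡.refl , qy) → proj₂ (from y qy) , proj₁ (from y qy) }) ⟩
      _ ≈⟨ when-× (x ≟A ψ y) (Q? y) ⟨
      _ ∎

  ∑-bijection : ∀ {_≟A_ : DecidableEquality A} {_≟B_ : DecidableEquality B} {xs ys} →
    Enumerates _≟A_ xs → Enumerates _≟B_ ys → ∀ (φ : A → B) (ψ : B → A) →
    (∀ x → ψ (φ x) ≡ x) → (∀ y → φ (ψ y) ≡ y) → ∀ f → ∑ xs (f ∘ φ) ≈ ∑ ys f
  ∑-bijection δA δB φ ψ ψφ φψ = reindex δA δB {P = λ _ → ⊤} {Q = λ _ → ⊤} (λ _ → yes tt) (λ _ → yes tt) φ ψ
    (λ x _ → tt , ≡.sym (ψφ x)) (λ y _ → tt , ≡.sym (φψ y))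

  ∑-involution : ∀ {_≟A_ : DecidableEquality A} {xs} → Enumerates _≟A_ xs →
    ∀ (φ : A → A) → (∀ x → φ (φ x) ≡ x) → ∀ f → ∑ xs (f ∘ φ) ≈ ∑ xs f
  ∑-involution δ φ inv = ∑-bijection δ δ φ φ inv inv

-- Formal power series

Central : (𝓡 : Ring c ℓ) → Ring.Carrier 𝓡 → Set (c ⊔ ℓ)
Central 𝓡 x = ∀ y → x * y ≈ y * x
  where open Ring 𝓡

-- The recursion satisfied by c(N) = 1/(v − N).
IsReciprocal : (𝓡 : Ring c ℓ) → (ℕ → Ring.Carrier 𝓡) → Set ℓ
IsReciprocal 𝓡 c = ∀ N → c (suc N) ≈ c N + c N * c (suc N)
  where open Ring 𝓡

module CentralElements (𝓡 : Ring c ℓ) where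
  open Ring 𝓡
  open BigOps rawRing
  open import Relation.Binary.Reasoning.Setoid setoid

  private variable
    x y : Carrier

  central-0 : Central 𝓡 0#
  central-0 y = trans (zeroˡ y) (sym (zeroʳ y))

  central-1 : Central 𝓡 1#
  central-1 y = trans (*-identityˡ y) (sym (*-identityʳ y))

  central-+ : Central 𝓡 x → Central 𝓡 y → Central 𝓡 (x + y)
  central-+ cx cy w = trans (distribʳ w _ _) (trans (+-cong (cx w) (cy w)) (sym (distribˡ w _ _)))

  central-* : Central 𝓡 x → Central 𝓡 y → Central 𝓡 (x * y)
  central-* {x} {y} cx cy w = begin
    x * y * w   ≈⟨ *-assoc x y w ⟩
    x * (y * w) ≈⟨ *-congˡ (cy w) ⟩
    x * (w * y) ≈⟨ *-assoc x w y ⟨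
    x * w * y   ≈⟨ *-congʳ (cx w) ⟩
    w * x * y   ≈⟨ *-assoc w x y ⟩
    w * (x * y) ∎

  central-^ : Central 𝓡 x → ∀ k → Central 𝓡 (x ^ k)
  central-^ cx ℕ.zero    = central-1
  central-^ cx (suc k) = central-* cx (central-^ cx k)

  central-· : Central 𝓡 x → ∀ k → Central 𝓡 (k · x)
  central-· cx ℕ.zero    = central-0
  central-· cx (suc k) = central-+ cx (central-· cx k)

  swap-central : Central 𝓡 y → ∀ x z → x * (y * z) ≈ y * (x * z)
  swap-central cy x z = trans (sym (*-assoc x _ z)) (trans (*-congʳ (sym (cy x))) (*-assoc _ x z))

module PowerSeriesRing (𝓡 : Ring c ℓ) where
  open Ring 𝓡 hiding (zero)
  open BigOps rawRing
  open FiniteSums 𝓡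
  open CentralElements 𝓡
  open import Relation.Binary.Reasoning.Setoid setoid
  private module S = RawRing (PowerSeries rawRing)

  private variable
    f g : S.Carrier

  ∑-applyUpTo : ∀ k (f : ℕ → Carrier) (g : ℕ → ℕ) → ∑ (applyUpTo g k) f ≈ ∑ (upTo k) (f ∘ g)
  ∑-applyUpTo zero    f g = refl
  ∑-applyUpTo (suc k) f g = +-congˡ (trans (∑-applyUpTo k f (g ∘ suc)) (sym (∑-applyUpTo k (f ∘ g) suc)))

  *-at-zero : ∀ f g → (f S.* g) 0 ≈ f 0 * g 0
  *-at-zero f g = +-identityʳ _

  *-at-suc : ∀ f g r → (f S.* g) (suc r) ≈ f 0 * g (suc r) + ((f ∘ suc) S.* g) r
  *-at-suc f g r = +-congˡ (∑-applyUpTo (suc r) (λ i → f i * g (suc r ∸ i)) suc)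

  -- The Cauchy product is indexed by the left factor, so peeling off the constant term of the right
  -- factor takes an induction of its own.
  *-at-sucʳ : ∀ f g r → (f S.* g) (suc r) ≈ (f S.* (g ∘ suc)) r + f (suc r) * g 0
  *-at-sucʳ f g zero    = trans (*-at-suc f g 0) (+-cong (sym (*-at-zero f (g ∘ suc))) (*-at-zero (f ∘ suc) g))
  *-at-sucʳ f g (suc r) = begin
    (f S.* g) (suc (suc r))
      ≈⟨ *-at-suc f g (suc r) ⟩
    f 0 * g (suc (suc r)) + ((f ∘ suc) S.* g) (suc r)
      ≈⟨ +-congˡ (*-at-sucʳ (f ∘ suc) g r) ⟩
    f 0 * g (suc (suc r)) + (((f ∘ suc) S.* (g ∘ suc)) r + f (suc (suc r)) * g 0)
      ≈⟨ +-assoc _ _ _ ⟨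
    f 0 * g (suc (suc r)) + ((f ∘ suc) S.* (g ∘ suc)) r + f (suc (suc r)) * g 0
      ≈⟨ +-congʳ (*-at-suc f (g ∘ suc) r) ⟨
    (f S.* (g ∘ suc)) (suc r) + f (suc (suc r)) * g 0 ∎

  ⋆-cong : ∀ {f g f′ g′} → f S.≈ g → f′ S.≈ g′ → (f S.* f′) S.≈ (g S.* g′)
  ⋆-cong f≈g f′≈g′ r = ∑-cong (upTo (suc r)) λ i → *-cong (f≈g i) (f′≈g′ (r ∸ i))

  ⋆-distribʳ : ∀ h f g → ((f S.+ g) S.* h) S.≈ ((f S.* h) S.+ (g S.* h))
  ⋆-distribʳ h f g r = trans (∑-cong (upTo (suc r)) λ i → distribʳ _ _ _) (∑-+ (upTo (suc r)) _ _)

  ⋆-distribˡ : ∀ h f g → (h S.* (f S.+ g)) S.≈ ((h S.* f) S.+ (h S.* g))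
  ⋆-distribˡ h f g r = trans (∑-cong (upTo (suc r)) λ i → distribˡ _ _ _) (∑-+ (upTo (suc r)) _ _)

  scale-⋆ : ∀ x f g → ((λ i → x * f i) S.* g) S.≈ (λ r → x * (f S.* g) r)
  scale-⋆ x f g r = trans (∑-cong (upTo (suc r)) λ i → *-assoc _ _ _) (sym (*-∑ (upTo (suc r)) _ x))

  zero-⋆ : ∀ g r → (S.0# S.* g) r ≈ 0#
  zero-⋆ g r = ∑-zero (upTo (suc r)) λ i → zeroˡ _

  ⋆-zero : ∀ g r → (g S.* S.0#) r ≈ 0#
  ⋆-zero g r = ∑-zero (upTo (suc r)) λ i → zeroʳ _

  -- Induction on the order of the coefficient avoids rearranging a double sum: dropping the
  -- constant term of f g and dividing by z leaves f₀ times the tail of g plus the tail of f times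
  -- g.
  ⋆-assoc : ∀ f g h → ((f S.* g) S.* h) S.≈ (f S.* (g S.* h))
  ⋆-assoc f g h zero = begin
    ((f S.* g) S.* h) 0 ≈⟨ *-at-zero (f S.* g) h ⟩
    (f S.* g) 0 * h 0   ≈⟨ *-congʳ (*-at-zero f g) ⟩
    f 0 * g 0 * h 0     ≈⟨ *-assoc _ _ _ ⟩
    f 0 * (g 0 * h 0)   ≈⟨ *-congˡ (*-at-zero g h) ⟨
    f 0 * (g S.* h) 0   ≈⟨ *-at-zero f (g S.* h) ⟨
    (f S.* (g S.* h)) 0 ∎
  ⋆-assoc f g h (suc r) = begin
    ((f S.* g) S.* h) (suc r)
      ≈⟨ *-at-suc (f S.* g) h r ⟩
    (f S.* g) 0 * h (suc r) + (((f S.* g) ∘ suc) S.* h) r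
      ≈⟨ +-cong (trans (*-congʳ (*-at-zero f g)) (*-assoc _ _ _)) (begin
        (((f S.* g) ∘ suc) S.* h) r
          ≈⟨ ⋆-cong {f′ = h} (*-at-suc f g) (λ _ → refl) r ⟩
        (((λ i → f 0 * g (suc i)) S.+ ((f ∘ suc) S.* g)) S.* h) r
          ≈⟨ ⋆-distribʳ h (λ i → f 0 * g (suc i)) ((f ∘ suc) S.* g) r ⟩
        ((λ i → f 0 * g (suc i)) S.* h) r + (((f ∘ suc) S.* g) S.* h) r
          ≈⟨ +-cong (scale-⋆ (f 0) (g ∘ suc) h r) (⋆-assoc (f ∘ suc) g h r) ⟩
        f 0 * ((g ∘ suc) S.* h) r + ((f ∘ suc) S.* (g S.* h)) r ∎) ⟩
    f 0 * (g 0 * h (suc r)) + (f 0 * ((g ∘ suc) S.* h) r + ((f ∘ suc) S.* (g S.* h)) r)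
      ≈⟨ +-assoc _ _ _ ⟨
    f 0 * (g 0 * h (suc r)) + f 0 * ((g ∘ suc) S.* h) r + ((f ∘ suc) S.* (g S.* h)) r
      ≈⟨ +-congʳ (trans (*-congˡ (*-at-suc g h r)) (distribˡ _ _ _)) ⟨
    f 0 * (g S.* h) (suc r) + ((f ∘ suc) S.* (g S.* h)) r
      ≈⟨ *-at-suc f (g S.* h) r ⟨
    (f S.* (g S.* h)) (suc r) ∎

  open Series rawRing using (C; 1/[u-_])

  C-⋆ : ∀ x f r → (C x S.* f) r ≈ x * f r
  C-⋆ x f zero    = *-at-zero (C x) f
  C-⋆ x f (suc r) = trans (*-at-suc (C x) f r) (trans (+-congˡ (zero-⋆ f r)) (+-identityʳ _))

  ⋆-identityˡ : ∀ f → (S.1# S.* f) S.≈ f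
  ⋆-identityˡ f zero    = trans (*-at-zero S.1# f) (*-identityˡ _)
  ⋆-identityˡ f (suc r) = trans (*-at-suc S.1# f r) (trans (+-cong (*-identityˡ _) (zero-⋆ f r)) (+-identityʳ _))

  ⋆-identityʳ : ∀ f → (f S.* S.1#) S.≈ f
  ⋆-identityʳ f zero    = trans (*-at-zero f S.1#) (*-identityʳ _)
  ⋆-identityʳ f (suc r) = trans (*-at-sucʳ f S.1# r) (trans (+-cong (⋆-zero f r) (*-identityʳ _)) (+-identityˡ _))

  powerSeriesRing : Ring c ℓ
  powerSeriesRing = record
    { Carrier = S.Carrier ; _≈_ = S._≈_ ; _+_ = S._+_ ; _*_ = S._*_ ; -_ = S.-_ ; 0# = S.0# ; 1# = S.1#
    ; isRing = record
      { +-isAbelianGroup = record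
        { isGroup = record
          { isMonoid = record
            { isSemigroup = record
              { isMagma = record
                { isEquivalence = record
                  { refl = λ _ → refl ; sym = λ e r → sym (e r) ; trans = λ e e′ r → trans (e r) (e′ r) }
                ; ∙-cong = λ e e′ r → +-cong (e r) (e′ r) }
              ; assoc = λ f g h r → +-assoc _ _ _ }
            ; identity = (λ f r → +-identityˡ _) , (λ f r → +-identityʳ _) }
          ; inverse = (λ f r → -‿inverseˡ _) , (λ f r → -‿inverseʳ _)
          ; ⁻¹-cong = λ e r → -‿cong (e r) }
        ; comm = λ f g r → +-comm _ _ }
      ; *-cong = λ e e′ → ⋆-cong e e′
      ; *-assoc = ⋆-assoc
      ; *-identity = ⋆-identityˡ , ⋆-identityʳ
      ; distrib = ⋆-distribˡ , ⋆-distribʳ } }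

  -- Expanding f g from the front and g f from the back peels off the same coefficient `f 0`, which
  -- leaves the tail of f for the induction.
  central-series : (∀ r → Central 𝓡 (f r)) → Central powerSeriesRing f
  central-series {f} cf g zero    = trans (*-at-zero f g) (trans (cf 0 (g 0)) (sym (*-at-zero g f)))
  central-series {f} cf g (suc r) = begin
    (f S.* g) (suc r)                            ≈⟨ *-at-suc f g r ⟩
    f 0 * g (suc r) + ((f ∘ suc) S.* g) r        ≈⟨ +-cong (cf 0 _) (central-series (cf ∘ suc) g r) ⟩
    g (suc r) * f 0 + (g S.* (f ∘ suc)) r        ≈⟨ +-comm _ _ ⟩
    (g S.* (f ∘ suc)) r + g (suc r) * f 0        ≈⟨ *-at-sucʳ g f r ⟨
    (g S.* f) (suc r)                            ∎

  module _ {h : Carrier} (central-h : Central 𝓡 h) where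

    central-C : ∀ r → Central 𝓡 (C h r)
    central-C zero    = central-h
    central-C (suc r) = central-0

    central-1/[u-·] : ∀ k r → Central 𝓡 (1/[u- k · h ] r)
    central-1/[u-·] k zero    = central-0
    central-1/[u-·] k (suc r) = central-^ (central-· central-h k) r

    -- h/(u − kh) = 1/(h⁻¹u − k) when h is invertible
    recip : ℕ → S.Carrier
    recip k = C h S.* 1/[u- k · h ]

    central-recip : ∀ k → Central powerSeriesRing (recip k)
    central-recip k = CentralElements.central-* powerSeriesRing
      (central-series central-C) (central-series (central-1/[u-·] k))

    private module _ (k : ℕ) where
      x y : Carrier
      x = k · h
      y = suc k · h

      -- The identity yʳ - xʳ = (y - x) Σ xⁱ yʳ⁻¹⁻ⁱ with y - x = h; the sum is a Cauchy product
      -- because the coefficient of `1/[u- y ]` at t + 1 is yᵗ.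
      powers : ∀ r → y ^ r ≈ x ^ r + h * ((x ^_) S.* 1/[u- y ]) r
      powers zero = begin
        1#                                       ≈⟨ +-identityʳ _ ⟨
        1# + 0#                                  ≈⟨ +-congˡ (zeroʳ h) ⟨
        1# + h * 0#                              ≈⟨ +-congˡ (*-congˡ (zeroʳ 1#)) ⟨
        1# + h * (1# * 0#)                       ≈⟨ +-congˡ (*-congˡ (*-at-zero (x ^_) 1/[u- y ])) ⟨
        1# + h * ((x ^_) S.* 1/[u- y ]) 0        ∎
      powers (suc r) = begin
        (h + x) * y ^ r
          ≈⟨ distribʳ _ h x ⟩
        h * y ^ r + x * y ^ r
          ≈⟨ +-congˡ (*-congˡ (powers r)) ⟩
        h * y ^ r + x * (x ^ r + h * w)
          ≈⟨ +-congˡ (trans (distribˡ x _ _) (+-congˡ (swap-central central-h x w))) ⟩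
        h * y ^ r + (x ^ suc r + h * (x * w))
          ≈⟨ trans (sym (+-assoc _ _ _)) (trans (+-congʳ (+-comm _ _)) (+-assoc _ _ _)) ⟩
        x ^ suc r + (h * y ^ r + h * (x * w))
          ≈⟨ +-congˡ (distribˡ h _ _) ⟨
        x ^ suc r + h * (y ^ r + x * w)
          ≈⟨ +-congˡ (*-congˡ (+-cong (*-identityˡ _) (scale-⋆ x (x ^_) 1/[u- y ] r))) ⟨
        x ^ suc r + h * (1# * y ^ r + ((λ i → x * x ^ i) S.* 1/[u- y ]) r)
          ≈⟨ +-congˡ (*-congˡ (*-at-suc (x ^_) 1/[u- y ] r)) ⟨
        x ^ suc r + h * ((x ^_) S.* 1/[u- y ]) (suc r) ∎
        where
        w : Carrier
        w = ((x ^_) S.* 1/[u- y ]) r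

      -- 1/(u - y) - 1/(u - x) = (y - x)/((u - x)(u - y)) and y - x = h. In coefficients this is
      -- `powers`, shifted by one power of u⁻¹.
      resolvent : ∀ r → 1/[u- y ] r ≈ 1/[u- x ] r + h * (1/[u- x ] S.* 1/[u- y ]) r
      resolvent zero    = begin
        0#                                       ≈⟨ +-identityʳ _ ⟨
        0# + 0#                                  ≈⟨ +-congˡ (zeroʳ h) ⟨
        0# + h * 0#                              ≈⟨ +-congˡ (*-congˡ (zeroʳ 0#)) ⟨
        0# + h * (0# * 0#)                       ≈⟨ +-congˡ (*-congˡ (*-at-zero 1/[u- x ] 1/[u- y ])) ⟨
        0# + h * (1/[u- x ] S.* 1/[u- y ]) 0     ∎
      resolvent (suc r) = begin
        y ^ r ≈⟨ powers r ⟩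
        x ^ r + h * ((x ^_) S.* 1/[u- y ]) r
          ≈⟨ +-congˡ (*-congˡ (+-identityˡ _)) ⟨
        x ^ r + h * (0# + ((x ^_) S.* 1/[u- y ]) r)
          ≈⟨ +-congˡ (*-congˡ (+-congʳ (zeroˡ _))) ⟨
        x ^ r + h * (0# * y ^ r + ((x ^_) S.* 1/[u- y ]) r)
          ≈⟨ +-congˡ (*-congˡ (*-at-suc 1/[u- x ] 1/[u- y ] r)) ⟨
        x ^ r + h * (1/[u- x ] S.* 1/[u- y ]) (suc r) ∎

    -- The resolvent identity multiplied by h: in the quadratic term the two factors h are
    -- distributed over the two fractions.
    recip-suc : IsReciprocal powerSeriesRing recip
    recip-suc k r = begin
      (C h S.* s′) r
        ≈⟨ C-⋆ h s′ r ⟩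
      h * s′ r
        ≈⟨ *-congˡ (resolvent k r) ⟩
      h * (s r + h * (s S.* s′) r)
        ≈⟨ distribˡ h _ _ ⟩
      h * s r + h * (h * (s S.* s′) r)
        ≈⟨ +-cong (C-⋆ h s r) (trans (C-⋆ h (C h S.* (s S.* s′)) r) (*-congˡ (C-⋆ h (s S.* s′) r))) ⟨
      (C h S.* s) r + (C h S.* (C h S.* (s S.* s′))) r
        ≈⟨ +-congˡ (⋆-cong {C h} {C h} (λ _ → refl) (swap-central′ s s′) r) ⟨
      (C h S.* s) r + (C h S.* (s S.* (C h S.* s′))) r
        ≈⟨ +-congˡ (⋆-assoc (C h) s (C h S.* s′) r) ⟨
      (C h S.* s) r + ((C h S.* s) S.* (C h S.* s′)) r ∎
      where
      s s′ : S.Carrier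
      s  = 1/[u- k · h ]
      s′ = 1/[u- suc k · h ]
      swap-central′ = CentralElements.swap-central powerSeriesRing {C h} (central-series central-C)

-- Alternating row vectors

lookup-ext : {v w : Vec A ν} → (∀ t → lookup v t ≡ lookup w t) → v ≡ w
lookup-ext {v = v} {w} eq = ≡.trans (≡.sym (tabulate∘lookup v)) (≡.trans (tabulate-cong eq) (tabulate∘lookup w))

transpose-left : ∀ (i j : Fin ν) → transpose i j i ≡ j
transpose-left i j with i ≟ i
... | yes _  = ≡.refl
... | no i≢i = contradiction ≡.refl i≢i

transpose-right : ∀ (i j : Fin ν) → transpose i j j ≡ i
transpose-right i j with j ≟ i
... | yes j≡i = j≡i
... | no _ with j ≟ j
...   | yes _  = ≡.refl
...   | no j≢j = contradiction ≡.refl j≢j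

transpose-other : ∀ {i j t : Fin ν} → t ≢ i → t ≢ j → transpose i j t ≡ t
transpose-other {i = i} {j} {t} t≢i t≢j with t ≟ i
... | yes t≡i = contradiction t≡i t≢i
... | no _ with t ≟ j
...   | yes t≡j = contradiction t≡j t≢j
...   | no _    = ≡.refl

transpose-involutive : ∀ (i j t : Fin ν) → transpose i j (transpose i j t) ≡ t
transpose-involutive i j t = case t ≟ i of λ where
  (yes ≡.refl) → ≡.trans (cong (transpose i j) (transpose-left i j)) (transpose-right i j)
  (no t≢i) → case t ≟ j of λ where
    (yes ≡.refl) → ≡.trans (cong (transpose i j) (transpose-right i j)) (transpose-left i j)
    (no t≢j) → ≡.trans (cong (transpose i j) (transpose-other t≢i t≢j)) (transpose-other t≢i t≢j)

transpose-injective : ∀ (i j : Fin ν) {s t} → transpose i j s ≡ transpose i j t → s ≡ t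
transpose-injective i j eq =
  ≡.trans (≡.sym (transpose-involutive i j _)) (≡.trans (cong (transpose i j) eq) (transpose-involutive i j _))

transpose-conj : ∀ {τ : Fin ν → Fin ν} → (∀ {s t} → τ s ≡ τ t → s ≡ t) →
                 ∀ i j t → transpose (τ i) (τ j) (τ t) ≡ τ (transpose i j t)
transpose-conj {τ = τ} inj i j t = case t ≟ i of λ where
  (yes ≡.refl) → ≡.trans (transpose-left (τ i) (τ j)) (cong τ (≡.sym (transpose-left i j)))
  (no t≢i) → case t ≟ j of λ where
    (yes ≡.refl) → ≡.trans (transpose-right (τ i) (τ j)) (cong τ (≡.sym (transpose-right i j)))
    (no t≢j) → ≡.trans (transpose-other (t≢i ∘ inj) (t≢j ∘ inj)) (cong τ (≡.sym (transpose-other t≢i t≢j)))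

transpose-≥ : ∀ {N} {i j : Fin ν} → N ℕ.≤ toℕ i → N ℕ.≤ toℕ j → ∀ {t} → N ℕ.≤ toℕ t → N ℕ.≤ toℕ (transpose i j t)
transpose-≥ {N = N} {i} {j} N≤i N≤j {t} N≤t = case t ≟ i of λ where
  (yes ≡.refl) → subst (λ s → N ℕ.≤ toℕ s) (≡.sym (transpose-left i j)) N≤j
  (no t≢i) → case t ≟ j of λ where
    (yes ≡.refl) → subst (λ s → N ℕ.≤ toℕ s) (≡.sym (transpose-right i j)) N≤i
    (no t≢j) → subst (λ s → N ℕ.≤ toℕ s) (≡.sym (transpose-other t≢i t≢j)) N≤t

-- The permuted word in the definition of `P`: multiplying a row by P_{ij} from the right composes
-- it with `swap i j`.
swap : (i j : Fin k) → Word d k → Word d k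
swap i j q = Vec.tabulate (lookup q ∘ transpose i j)

lookup-swap : ∀ (i j : Fin k) (q : Word d k) t → lookup (swap i j q) t ≡ lookup q (transpose i j t)
lookup-swap i j q t = lookup∘tabulate _ t

swap-involutive : ∀ (i j : Fin k) (q : Word d k) → swap i j (swap i j q) ≡ q
swap-involutive i j q = lookup-ext λ t → ≡.trans (lookup-swap i j (swap i j q) t)
  (≡.trans (lookup-swap i j q (transpose i j t)) (cong (lookup q) (transpose-involutive i j t)))

-- P_{ij} P_{im} = P_{jm} P_{ij}
swap-swap : ∀ {i j m : Fin k} → i ≢ m → j ≢ m → ∀ (q : Word d k) →
            swap i j (swap i m q) ≡ swap j m (swap i j q)
swap-swap {i = i} {j} {m} i≢m j≢m q = lookup-ext λ t → begin
  lookup (swap i j (swap i m q)) t               ≡⟨ lookup-swap i j (swap i m q) t ⟩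
  lookup (swap i m q) (transpose i j t)          ≡⟨ lookup-swap i m q _ ⟩
  lookup q (transpose i m (transpose i j t))     ≡⟨ cong (lookup q) (conj t) ⟩
  lookup q (transpose i j (transpose j m t))     ≡⟨ lookup-swap i j q _ ⟨
  lookup (swap i j q) (transpose j m t)          ≡⟨ lookup-swap j m (swap i j q) t ⟨
  lookup (swap j m (swap i j q)) t               ∎
  where
  open ≡.≡-Reasoning
  -- For τ = (i j) one has τ(j) = i and τ(m) = m, so (i m) is the conjugate of (j m) by τ.
  conj : ∀ t → transpose i m (transpose i j t) ≡ transpose i j (transpose j m t)
  conj t = ≡.trans
    (cong₂ (λ x y → transpose x y (transpose i j t)) (≡.sym (transpose-right i j))
      (≡.sym (transpose-other (≢-sym i≢m) (≢-sym j≢m))))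
    (transpose-conj (transpose-injective i j) j m t)

module RowVectors (𝓡 : Ring c ℓ) (d k : ℕ) where
  open Ring 𝓡 hiding (zero)
  open BigOps rawRing
  open FiniteSums 𝓡
  open import Relation.Binary.Reasoning.Setoid setoid
  open Tensor d k rawRing
  private
    module T = RawRing (End^⊗ d k rawRing)
    module TOps = BigOps (End^⊗ d k rawRing)

  Row : Set c
  Row = Word d k → Carrier

  infixl 7 _⋆_
  _⋆_ : Row → T.Carrier → Row
  (w ⋆ X) q = ∑ (words d k) λ p → w p * X p q

  infix 4 _≈ʳ_
  _≈ʳ_ : Row → Row → Set ℓ
  v ≈ʳ w = ∀ q → v q ≈ w q

  ⋆-congˡ : ∀ {v w} X → v ≈ʳ w → v ⋆ X ≈ʳ w ⋆ X
  ⋆-congˡ X v≈w q = ∑-cong (words d k) λ p → *-congʳ (v≈w p)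

  ⋆-* : ∀ w X Y → w ⋆ (X T.* Y) ≈ʳ w ⋆ X ⋆ Y
  ⋆-* w X Y q = begin
    ∑ ws (λ p → w p * ∑ ws (λ r → X p r * Y r q))
      ≈⟨ ∑-cong ws (λ p → *-∑ ws _ (w p)) ⟩
    ∑ ws (λ p → ∑ ws (λ r → w p * (X p r * Y r q)))
      ≈⟨ ∑-swap ws ws _ ⟩
    ∑ ws (λ r → ∑ ws (λ p → w p * (X p r * Y r q)))
      ≈⟨ ∑-cong ws (λ r → ∑-cong ws λ p → sym (*-assoc (w p) (X p r) (Y r q))) ⟩
    ∑ ws (λ r → ∑ ws (λ p → w p * X p r * Y r q))
      ≈⟨ ∑-cong ws (λ r → ∑-* ws _ (Y r q)) ⟨
    ∑ ws (λ r → (w ⋆ X) r * Y r q) ∎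
    where ws = words d k

  ⋆-δ : ∀ w (q : Word d k) → ∑ (words d k) (λ p → w p * when (p ≟ʷ q) 1#) ≈ w q
  ⋆-δ w q = trans (∑-cong (words d k) λ p → trans (*-when (p ≟ʷ q)) (when-cong (p ≟ʷ q) λ _ → *-identityʳ _))
                  (∑-δ-words d k w q)

  ⋆-1 : ∀ w → w ⋆ T.1# ≈ʳ w
  ⋆-1 w q = ⋆-δ w q

  ⋆-P : ∀ w i j → w ⋆ P i j ≈ʳ w ∘ swap i j
  ⋆-P w i j q = ⋆-δ w (swap i j q)

  ⋆-∑ : ∀ (xs : List A) (e : A → Carrier) (ws : A → Row) X →
        (λ q → ∑ xs λ x → e x * ws x q) ⋆ X ≈ʳ (λ q → ∑ xs λ x → e x * (ws x ⋆ X) q)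
  ⋆-∑ xs e ws X q = begin
    ∑ W (λ p → ∑ xs (λ x → e x * ws x p) * X p q)
      ≈⟨ ∑-cong W (λ p → trans (∑-* xs _ _) (∑-cong xs λ x → *-assoc _ _ _)) ⟩
    ∑ W (λ p → ∑ xs (λ x → e x * (ws x p * X p q)))
      ≈⟨ ∑-swap W xs _ ⟩
    ∑ xs (λ x → ∑ W (λ p → e x * (ws x p * X p q)))
      ≈⟨ ∑-cong xs (λ x → *-∑ W _ (e x)) ⟨
    ∑ xs (λ x → e x * (ws x ⋆ X) q) ∎
    where W = words d k

  neg-⋆ : ∀ w X → (λ p → - w p) ⋆ X ≈ʳ λ q → - (w ⋆ X) q
  neg-⋆ w X q = trans (∑-cong (words d k) λ p → sym (-‿distribˡ-* (w p) (X p q))) (∑-neg (words d k) _)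

  ⋆-+ : ∀ w X Y → w ⋆ (X T.+ Y) ≈ʳ λ q → (w ⋆ X) q + (w ⋆ Y) q
  ⋆-+ w X Y q = trans (∑-cong (words d k) λ p → distribˡ (w p) _ _) (∑-+ (words d k) _ _)

  ⋆-neg : ∀ w X → w ⋆ (T.- X) ≈ʳ λ q → - (w ⋆ X) q
  ⋆-neg w X q = trans (∑-cong (words d k) λ p → sym (-‿distribʳ-* (w p) (X p q))) (∑-neg (words d k) _)

  ⋆-• : ∀ w {x} → Central 𝓡 x → ∀ X → w ⋆ (x • X) ≈ʳ λ q → x * (w ⋆ X) q
  ⋆-• w {x} cx X q = trans (∑-cong (words d k) λ p → CentralElements.swap-central 𝓡 cx (w p) (X p q))
                       (sym (*-∑ (words d k) _ x))

  -- The entries of P_{ij} M_s P_{ij} = M_{τ(s)} for τ = (i j): the condition of agreement outside s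
  -- is carried along by τ.
  at-swap : ∀ M s (i j : Fin k) p q → (M at s) (swap i j p) (swap i j q) ≈ (M at transpose i j s) p q
  at-swap M s i j p q = trans
    (when-⇔ (all? λ t → (t ≟ s) ⊎-dec (lookup (swap i j p) t ≟ lookup (swap i j q) t))
            (all? λ t → (t ≟ transpose i j s) ⊎-dec (lookup p t ≟ lookup q t)) to from)
    (when-cong (all? λ t → (t ≟ transpose i j s) ⊎-dec (lookup p t ≟ lookup q t))
      λ _ → reflexive (cong₂ M (lookup-swap i j p s) (lookup-swap i j q s)))
    where
    to : (∀ t → t ≡ s ⊎ lookup (swap i j p) t ≡ lookup (swap i j q) t) →
         ∀ t → t ≡ transpose i j s ⊎ lookup p t ≡ lookup q t
    to agree t with agree (transpose i j t)
    ... | inj₁ eq = inj₁ (≡.trans (≡.sym (transpose-involutive i j t)) (cong (transpose i j) eq))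
    ... | inj₂ eq = inj₂ (≡.trans (unswap p) (≡.trans eq (≡.sym (unswap q))))
      where
      unswap : ∀ r → lookup r t ≡ lookup (swap i j r) (transpose i j t)
      unswap r = ≡.trans (cong (lookup r) (≡.sym (transpose-involutive i j t)))
                         (≡.sym (lookup-swap i j r (transpose i j t)))
    from : (∀ t → t ≡ transpose i j s ⊎ lookup p t ≡ lookup q t) →
           ∀ t → t ≡ s ⊎ lookup (swap i j p) t ≡ lookup (swap i j q) t
    from agree t with agree (transpose i j t)
    ... | inj₁ eq = inj₁ (transpose-injective i j eq)
    ... | inj₂ eq = inj₂ (≡.trans (lookup-swap i j p t) (≡.trans eq (≡.sym (lookup-swap i j q t))))

  ⋆-at-swap : ∀ w M s i j → (w ⋆ (M at s)) ∘ swap i j ≈ʳ (w ∘ swap i j) ⋆ (M at transpose i j s)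
  ⋆-at-swap w M s i j q = begin
    ∑ W (λ p → w p * (M at s) p (swap i j q))
      ≈⟨ ∑-involution (enumerates-words d k) (swap i j) (swap-involutive i j) (λ p → w p * (M at s) p (swap i j q)) ⟨
    ∑ W (λ p → w (swap i j p) * (M at s) (swap i j p) (swap i j q))
      ≈⟨ ∑-cong W (λ p → *-congˡ (at-swap M s i j p q)) ⟩
    ∑ W (λ p → w (swap i j p) * (M at transpose i j s) p q) ∎
    where W = words d k

  -- Slots count from 0 here: N = 0 means full antisymmetry, and N = `suc (toℕ i)` means
  -- antisymmetry in the slots strictly after i.
  Alternating≥ : ℕ → Row → Set ℓ
  Alternating≥ N w = ∀ {i j} → N ℕ.≤ toℕ i → N ℕ.≤ toℕ j → i ≢ j → ∀ q → w (swap i j q) ≈ - w q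

  -- Moving P_{ij} to the left past M_s replaces s by τ(s), after which w absorbs P_{ij} with a
  -- sign. The slot may thus change, so w M_s inherits the antisymmetry only under transpositions
  -- that fix s.
  alternating-at : ∀ {w N} → Alternating≥ N w → ∀ M s {i j} → N ℕ.≤ toℕ i → N ℕ.≤ toℕ j → i ≢ j →
                   (w ⋆ (M at s)) ∘ swap i j ≈ʳ λ q → - (w ⋆ (M at transpose i j s)) q
  alternating-at {w = w} alt M s {i} {j} N≤i N≤j i≢j q = begin
    (w ⋆ (M at s)) (swap i j q)                      ≈⟨ ⋆-at-swap w M s i j q ⟩
    ((w ∘ swap i j) ⋆ (M at transpose i j s)) q      ≈⟨ ⋆-congˡ (M at transpose i j s) (alt N≤i N≤j i≢j) q ⟩
    ((λ p → - w p) ⋆ (M at transpose i j s)) q       ≈⟨ neg-⋆ w (M at transpose i j s) q ⟩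
    - (w ⋆ (M at transpose i j s)) q                 ∎

  module Contraction (c : ℕ → Carrier) (central-c : ∀ N → Central 𝓡 (c N))
                     (c-suc : IsReciprocal 𝓡 c) where

    -- The value `c N` stands for 1/(2u - N); the argument here equals `toℕ i ℕ.+ toℕ j`.
    R : Fin k → Fin k → T.Carrier
    R i j = T.1# T.+ T.- (c (pos i ℕ.+ pos j ∸ 2) • P i j)

    ⋆-R : ∀ w i j → w ⋆ R i j ≈ʳ λ q → w q + - (c (pos i ℕ.+ pos j ∸ 2) * w (swap i j q))
    ⋆-R w i j q = trans (⋆-+ w T.1# (T.- (s • P i j)) q) (+-cong (⋆-1 w q)
      (trans (⋆-neg w (s • P i j) q) (-‿cong (trans (⋆-• w (central-c _) (P i j) q) (*-congˡ (⋆-P w i j q))))))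
      where s = c (pos i ℕ.+ pos j ∸ 2)

    module _ (i : Fin k) (v : Row) (alt : Alternating≥ (suc (toℕ i)) v) where

      swaps : ℕ → Row
      swaps t q = ∑ (allFin k) λ j → when (i <? j) (when (toℕ j ℕ.<? t) (v (swap i j q)))

      -- v P_{ij} P_{im} = v P_{jm} P_{ij} = −v P_{ij} for i < j < m, so c(N+1) = c(N) + c(N) c(N+1)
      -- makes the product of R-matrices telescope.
      partial : ℕ → Row
      partial t q = v q + - (c (toℕ i ℕ.+ t ∸ 1) * swaps t q)

      swaps-suc : ∀ {t} {m : Fin k} → toℕ m ≡ t → i Fin.< m → ∀ q →
                  swaps (suc t) q ≈ swaps t q + v (swap i m q)
      swaps-suc {t} {m} ≡.refl i<m q = begin
        swaps (suc (toℕ m)) q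
          ≈⟨ ∑-cong (allFin k) split ⟩
        ∑ (allFin k) (λ j → when (i <? j) (when (toℕ j ℕ.<? toℕ m) (x j)) + when (j ≟ m) (x j))
          ≈⟨ ∑-+ (allFin k) _ _ ⟩
        swaps (toℕ m) q + ∑ (allFin k) (λ j → when (j ≟ m) (x j))
          ≈⟨ +-congˡ (∑-δ-allFin k x m) ⟩
        swaps (toℕ m) q + x m ∎
        where
        x : Fin k → Carrier
        x j = v (swap i j q)
        split : ∀ j → when (i <? j) (when (toℕ j ℕ.<? suc (toℕ m)) (x j)) ≈
                      when (i <? j) (when (toℕ j ℕ.<? toℕ m) (x j)) + when (j ≟ m) (x j)
        split j = case j ≟ m of λ where
          (yes ≡.refl) → begin
            when (i <? j) (when (toℕ j ℕ.<? suc (toℕ j)) (x j))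
              ≈⟨ when-yes (i <? j) i<m ⟩
            when (toℕ j ℕ.<? suc (toℕ j)) (x j)
              ≈⟨ when-yes (toℕ j ℕ.<? suc (toℕ j)) (ℕ.n<1+n _) ⟩
            x j
              ≈⟨ +-identityˡ _ ⟨
            0# + x j
              ≈⟨ +-cong (trans (when-cong (i <? j) λ _ → when-no (toℕ j ℕ.<? toℕ j) (ℕ.n≮n _)) (when-0 (i <? j)))
                        (when-yes (j ≟ j) ≡.refl) ⟨
            when (i <? j) (when (toℕ j ℕ.<? toℕ j) (x j)) + when (j ≟ j) (x j) ∎
          (no j≢m) → begin
            when (i <? j) (when (toℕ j ℕ.<? suc (toℕ m)) (x j))
              ≈⟨ when-cong (i <? j) (λ _ → when-⇔ (toℕ j ℕ.<? suc (toℕ m)) (toℕ j ℕ.<? toℕ m)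
                   (λ j<1+m → ℕ.≤∧≢⇒< (ℕ.≤-pred j<1+m) (j≢m ∘ toℕ-injective)) ℕ.m<n⇒m<1+n) ⟩
            when (i <? j) (when (toℕ j ℕ.<? toℕ m) (x j))
              ≈⟨ +-identityʳ _ ⟨
            when (i <? j) (when (toℕ j ℕ.<? toℕ m) (x j)) + 0#
              ≈⟨ +-congˡ (when-no (j ≟ m) j≢m) ⟨
            when (i <? j) (when (toℕ j ℕ.<? toℕ m) (x j)) + when (j ≟ m) (x j) ∎

      swaps-swap : ∀ {t} {m : Fin k} → toℕ m ≡ t → i Fin.< m → ∀ q →
                   swaps t (swap i m q) ≈ - swaps t q
      swaps-swap {t} {m} ≡.refl i<m q = trans (∑-cong (allFin k) λ j →
          trans (when-cong (i <? j) λ i<j →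
              trans (when-cong (toℕ j ℕ.<? t) λ j<m →
                let j≢m = λ { ≡.refl → ℕ.n≮n _ j<m } in
                trans (reflexive (cong v (swap-swap (<⇒≢ i<m) j≢m q))) (alt i<j i<m j≢m (swap i j q)))
              (when-neg (toℕ j ℕ.<? t)))
            (when-neg (i <? j)))
        (∑-neg (allFin k) _)

      -- The index of c in `partial t` is that of the last factor R_{i,t-1}. Applying R_{im} to x -
      -- y z gives x - y z - y′ (x′ + y z), the inner sign coming from `swaps-swap`. The coefficient
      -- of z is then y + y y′, which is y′ by the recursion for c.
      partial-step : ∀ {t} {m : Fin k} → toℕ m ≡ t → i Fin.< m → partial t ⋆ R i m ≈ʳ partial (suc t)
      partial-step {suc t} {m} eq i<m q = begin
        (partial (suc t) ⋆ R i m) q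
          ≈⟨ ⋆-R (partial (suc t)) i m q ⟩
        partial (suc t) q + - (c (pos i ℕ.+ pos m ∸ 2) * partial (suc t) (swap i m q))
          ≈⟨ +-cong (+-congˡ (-‿cong (*-congʳ (reflexive (cong c e₀)))))
               (-‿cong (*-cong (reflexive (cong c e₁))
                 (+-congˡ (-‿cong (*-cong (reflexive (cong c e₀)) (swaps-swap eq i<m q)))))) ⟩
        (x + - (y * z)) + - (y′ * (x′ + - (y * - z)))
          ≈⟨ +-assoc _ _ _ ⟩
        x + (- (y * z) + - (y′ * (x′ + - (y * - z))))
          ≈⟨ +-congˡ (-‿+-comm _ _) ⟩
        x + - (y * z + y′ * (x′ + - (y * - z)))
          ≈⟨ +-congˡ (-‿cong (begin
            y * z + y′ * (x′ + - (y * - z))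
              ≈⟨ +-congˡ (*-congˡ (+-congˡ (trans (-‿cong (sym (-‿distribʳ-* y z))) (-‿involutive _)))) ⟩
            y * z + y′ * (x′ + y * z)
              ≈⟨ +-congˡ (trans (distribˡ y′ _ _) (+-comm _ _)) ⟩
            y * z + (y′ * (y * z) + y′ * x′)
              ≈⟨ +-assoc _ _ _ ⟨
            y * z + y′ * (y * z) + y′ * x′
              ≈⟨ +-congʳ (+-congˡ (trans (sym (*-assoc _ _ _)) (*-congʳ (central-c _ y)))) ⟩
            y * z + y * y′ * z + y′ * x′
              ≈⟨ +-congʳ (distribʳ z _ _) ⟨
            (y + y * y′) * z + y′ * x′
              ≈⟨ +-congʳ (*-congʳ (c-suc (toℕ i ℕ.+ t))) ⟨
            y′ * z + y′ * x′
              ≈⟨ distribˡ y′ _ _ ⟨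
            y′ * (z + x′) ∎)) ⟩
        x + - (y′ * (z + x′))
          ≈⟨ +-congˡ (-‿cong (*-cong (reflexive (cong c e₂)) (swaps-suc eq i<m q))) ⟨
        partial (suc (suc t)) q ∎
        where
        x x′ y y′ z : Carrier
        x  = v q
        x′ = v (swap i m q)
        y  = c (toℕ i ℕ.+ t)
        y′ = c (suc (toℕ i ℕ.+ t))
        z  = swaps (suc t) q
        e₀ : toℕ i ℕ.+ suc t ∸ 1 ≡ toℕ i ℕ.+ t
        e₀ = cong (_∸ 1) (ℕ.+-suc (toℕ i) t)
        e₁ : pos i ℕ.+ pos m ∸ 2 ≡ suc (toℕ i ℕ.+ t)
        e₁ rewrite eq | ℕ.+-suc (toℕ i) (suc t) = ℕ.+-suc (toℕ i) t
        e₂ : toℕ i ℕ.+ suc (suc t) ∸ 1 ≡ suc (toℕ i ℕ.+ t)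
        e₂ rewrite ℕ.+-suc (toℕ i) (suc t) = ℕ.+-suc (toℕ i) t
      partial-step {zero} {m} eq i<m q = contradiction (subst (toℕ i ℕ.<_) eq i<m) λ ()

      -- No j satisfies i < j < t, so the sum multiplying c is empty and the index of c, possibly
      -- truncated at t = 0, has no effect.
      partial-trivial : ∀ {t} → t ℕ.≤ suc (toℕ i) → partial t ≈ʳ v
      partial-trivial {t} t≤1+i q = begin
        v q + - (c _ * swaps t q)
          ≈⟨ +-congˡ (-‿cong (*-congˡ (∑-zero (allFin k) λ j →
               trans (when-cong (i <? j) λ i<j → when-no (toℕ j ℕ.<? t) λ j<t →
                        ℕ.n≮n _ (ℕ.<-≤-trans i<j (ℕ.≤-pred (ℕ.≤-trans j<t t≤1+i))))
                     (when-0 (i <? j))))) ⟩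
        v q + - (c _ * 0#) ≈⟨ +-congˡ (trans (-‿cong (zeroʳ _)) -0#≈0#) ⟩
        v q + 0#           ≈⟨ +-identityʳ _ ⟩
        v q                ∎

      -- Here κ lists the slots t, ..., k - 1, a tail of `allFin k`. The filter drops those up to i,
      -- during which `partial` stays equal to v; each later one contributes a factor R. The row u
      -- is tied to `partial t` only pointwise, as equality of rows is pointwise.
      partial-tail : ∀ ν t (κ : Fin ν → Fin k) → (∀ m → toℕ (κ m) ≡ t ℕ.+ toℕ m) → t ℕ.+ ν ≡ k →
        ∀ u → u ≈ʳ partial t → u ⋆ TOps.∏ (filter (i <?_) (tabulate κ)) (R i) ≈ʳ partial k
      partial-tail zero    t κ κ≡ t+0≡k u u≈ q = trans (⋆-1 u q)
        (trans (u≈ q) (reflexive (cong (λ s → partial s q) (≡.trans (≡.sym (ℕ.+-identityʳ t)) t+0≡k))))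
      partial-tail (suc ν) t κ κ≡ t+n≡k  u u≈ q with i <? κ zero
      ... | yes i<m rewrite filter-accept (i <?_) {xs = tabulate (κ ∘ suc)} i<m = trans (⋆-* u (R i (κ zero)) (TOps.∏ (filter (i <?_) (tabulate (κ ∘ suc))) (R i)) q)
              (partial-tail ν (suc t) (κ ∘ suc) (λ m → ≡.trans (κ≡ (suc m)) (ℕ.+-suc t _))
                (≡.trans (≡.sym (ℕ.+-suc t ν)) t+n≡k) (u ⋆ R i (κ zero))
                (λ r → trans (⋆-congˡ (R i (κ zero)) u≈ r)
                         (partial-step (≡.trans (κ≡ zero) (ℕ.+-identityʳ t)) i<m r)) q)
      ... | no i≮m rewrite filter-reject (i <?_) {xs = tabulate (κ ∘ suc)} i≮m = partial-tail ν (suc t) (κ ∘ suc) (λ m → ≡.trans (κ≡ (suc m)) (ℕ.+-suc t _))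
                (≡.trans (≡.sym (ℕ.+-suc t ν)) t+n≡k) u
                (λ r → trans (u≈ r) (trans (partial-trivial (ℕ.m≤n⇒m≤1+n t≤i) r) (sym (partial-trivial (s≤s t≤i) r)))) q
        where
        t≤i : t ℕ.≤ toℕ i
        t≤i = subst (ℕ._≤ toℕ i) (≡.trans (κ≡ zero) (ℕ.+-identityʳ t)) (ℕ.≮⇒≥ i≮m)

      -- The surviving coefficient is that of the last R-matrix. With i counted from 1 the index is
      -- i + k - 2, which is where 1/(2u + 2 - i - n) in the theorem comes from.
      ⋆-∏R : v ⋆ TOps.∏ (filter (i <?_) (allFin k)) (R i) ≈ʳ
             λ q → v q + - (c (toℕ i ℕ.+ k ∸ 1) * ∑ (allFin k) λ j → when (i <? j) (v (swap i j q)))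
      ⋆-∏R q = trans (partial-tail k 0 id (λ _ → ≡.refl) ≡.refl v (λ r → sym (partial-trivial z≤n r)) q)
        (+-congˡ (-‿cong (*-congˡ (∑-cong (allFin k) λ j → when-cong (i <? j) λ _ →
          when-yes (toℕ j ℕ.<? k) (toℕ<n j)))))

    -- The weight of the factor P_{ij}, up to the sign absorbed by the alternating row.
    weight : Fin k → Fin k → Carrier
    weight i j = when (j ≟ i) 1# + when (i <? j) (c (toℕ i ℕ.+ k ∸ 1))

    weight-central : ∀ i j → Central 𝓡 (weight i j)
    weight-central i j = central-+ (central-when (j ≟ i) central-1) (central-when (i <? j) (central-c _))
      where
      open CentralElements 𝓡
      central-when : ∀ {p} {P : Set p} {x} (d : Dec P) → Central 𝓡 x → Central 𝓡 (when d x)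
      central-when (yes _) cx = cx
      central-when (no _)  cx = central-0

    contract : Row → (Fin d → Fin d → Carrier) → Fin k → Row
    contract w M i q = ∑ (allFin k) λ j → weight i j * (w ⋆ (M at j)) q

    module _ {w : Row} {i : Fin k} (alt : Alternating≥ (toℕ i) w) (M : Fin d → Fin d → Carrier) where

      ⋆-factor : w ⋆ ((M at i) T.* TOps.∏ (filter (i <?_) (allFin k)) (R i)) ≈ʳ contract w M i
      ⋆-factor q = begin
        (w ⋆ ((M at i) T.* TOps.∏ (filter (i <?_) (allFin k)) (R i))) q
          ≈⟨ ⋆-* w (M at i) (TOps.∏ (filter (i <?_) (allFin k)) (R i)) q ⟩
        (v ⋆ TOps.∏ (filter (i <?_) (allFin k)) (R i)) q
          ≈⟨ ⋆-∏R i v alt-v q ⟩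
        v q + - (c₀ * ∑ (allFin k) (λ j → when (i <? j) (v (swap i j q))))
          ≈⟨ +-congˡ (trans (-‿distribʳ-* _ _) (*-congˡ (sym (∑-neg (allFin k) _)))) ⟩
        v q + c₀ * ∑ (allFin k) (λ j → - when (i <? j) (v (swap i j q)))
          ≈⟨ +-congˡ (trans (*-∑ (allFin k) _ c₀) (∑-cong (allFin k) term)) ⟩
        v q + ∑ (allFin k) (λ j → when (i <? j) c₀ * (w ⋆ (M at j)) q)
          ≈⟨ +-congʳ (∑-δ-allFin k (λ j → (w ⋆ (M at j)) q) i) ⟨
        ∑ (allFin k) (λ j → when (j ≟ i) ((w ⋆ (M at j)) q)) + ∑ (allFin k) (λ j → when (i <? j) c₀ * (w ⋆ (M at j)) q)
          ≈⟨ ∑-+ (allFin k) _ _ ⟨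
        ∑ (allFin k) (λ j → when (j ≟ i) ((w ⋆ (M at j)) q) + when (i <? j) c₀ * (w ⋆ (M at j)) q)
          ≈⟨ ∑-cong (allFin k) (λ j → trans (distribʳ _ _ _)
               (+-congʳ (trans (when-* (j ≟ i)) (when-cong (j ≟ i) λ _ → *-identityˡ _)))) ⟨
        contract w M i q ∎
        where
        c₀ : Carrier
        c₀ = c (toℕ i ℕ.+ k ∸ 1)
        v : Row
        v = w ⋆ (M at i)
        alt-v : Alternating≥ (suc (toℕ i)) v
        alt-v i<m i<n m≢n r = trans (alternating-at alt M i (ℕ.<⇒≤ i<m) (ℕ.<⇒≤ i<n) m≢n r)
          (-‿cong (reflexive (cong (λ s → (w ⋆ (M at s)) r)
            (transpose-other (<⇒≢ i<m) (<⇒≢ i<n)))))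
        term : ∀ j → c₀ * - when (i <? j) (v (swap i j q)) ≈ when (i <? j) c₀ * (w ⋆ (M at j)) q
        term j = begin
          c₀ * - when (i <? j) (v (swap i j q))
            ≈⟨ *-congˡ (when-neg (i <? j)) ⟨
          c₀ * when (i <? j) (- v (swap i j q))
            ≈⟨ *-congˡ (when-cong (i <? j) λ i<j → trans
                 (-‿cong (alternating-at alt M i ℕ.≤-refl (ℕ.<⇒≤ i<j) (<⇒≢ i<j) q))
                 (trans (-‿involutive _) (reflexive (cong (λ s → (w ⋆ (M at s)) q) (transpose-left i j))))) ⟩
          c₀ * when (i <? j) ((w ⋆ (M at j)) q)
            ≈⟨ trans (*-when (i <? j)) (sym (when-* (i <? j))) ⟩
          when (i <? j) c₀ * (w ⋆ (M at j)) q ∎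

      -- Transposing two slots after i permutes the summands w M_j with a sign. The weight of j
      -- depends only on whether j = i or j > i, and both conditions are preserved by the
      -- transposition, so the permuted sum is the original one.
      alternating-contract : Alternating≥ (suc (toℕ i)) (contract w M i)
      alternating-contract {m} {ν} i<m i<n m≢n q = begin
        ∑ (allFin k) (λ j → weight i j * (w ⋆ (M at j)) (swap m ν q))
          ≈⟨ ∑-cong (allFin k) (λ j → trans
               (*-congˡ (alternating-at alt M j (ℕ.<⇒≤ i<m) (ℕ.<⇒≤ i<n) m≢n q))
               (sym (-‿distribʳ-* _ _))) ⟩
        ∑ (allFin k) (λ j → - (weight i j * (w ⋆ (M at transpose m ν j)) q))
          ≈⟨ ∑-neg (allFin k) _ ⟩
        - ∑ (allFin k) (λ j → weight i j * (w ⋆ (M at transpose m ν j)) q)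
          ≈⟨ -‿cong (∑-cong (allFin k) λ j → *-congʳ (weight-transpose j)) ⟨
        - ∑ (allFin k) (λ j → weight i (transpose m ν j) * (w ⋆ (M at transpose m ν j)) q)
          ≈⟨ -‿cong (∑-involution (enumerates-allFin k) (transpose m ν) (transpose-involutive m ν)
               (λ j → weight i j * (w ⋆ (M at j)) q)) ⟩
        - contract w M i q ∎
        where
        τ = transpose m ν
        back : ∀ {P : Fin k → Set} {j} → P (τ (τ j)) → P j
        back {P} {j} = subst P (transpose-involutive m ν j)
        fixed : τ i ≡ i
        fixed = transpose-other (<⇒≢ i<m) (<⇒≢ i<n)
        weight-transpose : ∀ j → weight i (τ j) ≈ weight i j
        weight-transpose j = +-cong
          (when-⇔ (τ j ≟ i) (j ≟ i) (λ e → transpose-injective m ν (≡.trans e (≡.sym fixed)))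
             λ e → ≡.trans (cong τ e) fixed)
          (when-⇔ (i <? τ j) (i <? j)
             (λ i<τj → back {λ s → i Fin.< s} (transpose-≥ i<m i<n i<τj)) (transpose-≥ i<m i<n))

    -- Induction on the number of remaining blocks, which κ places at consecutive slots from t on; w
    -- is the row that has already absorbed the earlier blocks.
    expand : ∀ ν t (κ : Fin ν → Fin k) → (∀ m → toℕ (κ m) ≡ t ℕ.+ toℕ m) →
      ∀ (B : Fin ν → Fin d → Fin d → Carrier) {w} → Alternating≥ t w →
      w ⋆ TOps.∏ (allFin ν) (λ m → (B m at κ m) T.* TOps.∏ (filter (κ m <?_) (allFin k)) (R (κ m))) ≈ʳ
      λ q → ∑ (words k ν) λ η → ∏ (allFin ν) (λ m → weight (κ m) (lookup η m)) *
                                (w ⋆ TOps.∏ (allFin ν) (λ m → B m at lookup η m)) q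
    expand zero    t κ κ≡ B {w} alt q = sym (trans (+-identityʳ _) (*-identityˡ _))
    expand (suc ν) t κ κ≡ B {w} alt q = begin
      (w ⋆ (F zero T.* TOps.∏ (tabulate suc) F)) q
        ≈⟨ ⋆-* w (F zero) (TOps.∏ (tabulate suc) F) q ⟩
      (w ⋆ F zero ⋆ TOps.∏ (tabulate suc) F) q
        ≡⟨ cong (λ X → (w ⋆ F zero ⋆ X) q) (foldr-tabulate T._*_ T.1# suc F) ⟩
      (w ⋆ F zero ⋆ TOps.∏ (allFin ν) (F ∘ suc)) q
        ≈⟨ ⋆-congˡ (TOps.∏ (allFin ν) (F ∘ suc)) (⋆-factor alt-κ (B zero)) q ⟩
      (contract w (B zero) (κ zero) ⋆ TOps.∏ (allFin ν) (F ∘ suc)) q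
        -- The induction hypothesis is applied to the contracted row as a whole, since its separate
        -- summands are not alternating.
        ≈⟨ expand ν (suc t) (κ ∘ suc) (λ m → ≡.trans (κ≡ (suc m)) (ℕ.+-suc t _)) (B ∘ suc)
             (λ {i} {j} → subst (λ N → Alternating≥ N (contract w (B zero) (κ zero)))
               (cong suc κ₀≡t) (alternating-contract alt-κ (B zero)) {i} {j}) q ⟩
      ∑ (words k ν) (λ η → E η * (contract w (B zero) (κ zero) ⋆ X η) q)
        -- Only now is the sum over the first letter split off; the central weight moves to the left
        -- of the weights already collected.
        ≈⟨ ∑-cong (words k ν) (λ η → trans
             (*-congˡ (⋆-∑ (allFin k) (weight (κ zero)) (λ j → w ⋆ (B zero at j)) (X η) q))
             (trans (*-∑ (allFin k) _ (E η)) (∑-cong (allFin k) λ j →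
               trans (swap-central (weight-central (κ zero) j) (E η) _) (sym (*-assoc _ _ _))))) ⟩
      ∑ (words k ν) (λ η → ∑ (allFin k) λ j → weight (κ zero) j * E η * (w ⋆ (B zero at j) ⋆ X η) q)
        ≈⟨ ∑-swap (words k ν) (allFin k) _ ⟩
      ∑ (allFin k) (λ j → ∑ (words k ν) λ η → weight (κ zero) j * E η * (w ⋆ (B zero at j) ⋆ X η) q)
        ≈⟨ ∑-cong (allFin k) (λ j → ∑-cong (words k ν) λ η → *-cong
             (∏-allFin (λ m → weight (κ m) (lookup (j ∷ η) m)))
             (trans (reflexive (cong (λ Y → (w ⋆ ((B zero at j) T.* Y)) q)
                      (foldr-tabulate T._*_ T.1# suc (λ m → B m at lookup (j ∷ η) m))))
                    (⋆-* w (B zero at j) (X η) q))) ⟨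
      ∑ (allFin k) (λ j → ∑ (words k ν) λ η → G (j ∷ η))
        ≈⟨ ∑-words k ν G ⟨
      ∑ (words k (suc ν)) G ∎
      where
      open CentralElements 𝓡 using (swap-central)
      F : Fin (suc ν) → T.Carrier
      F m = (B m at κ m) T.* TOps.∏ (filter (κ m <?_) (allFin k)) (R (κ m))
      E : Word k ν → Carrier
      E η = ∏ (allFin ν) (λ m → weight (κ (suc m)) (lookup η m))
      X : Word k ν → T.Carrier
      X η = TOps.∏ (allFin ν) (λ m → B (suc m) at lookup η m)
      G : Word k (suc ν) → Carrier
      G η = ∏ (allFin (suc ν)) (λ m → weight (κ m) (lookup η m)) *
            (w ⋆ TOps.∏ (allFin (suc ν)) (λ m → B m at lookup η m)) q
      κ₀≡t : toℕ (κ zero) ≡ t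
      κ₀≡t = ≡.trans (κ≡ zero) (ℕ.+-identityʳ t)
      alt-κ : Alternating≥ (toℕ (κ zero)) w
      alt-κ {i} {j} = subst (λ N → Alternating≥ N w) (≡.sym κ₀≡t) alt {i} {j}

-- Permutations and signs

unique? : (σ : Word d k) → Dec (Unique σ)
unique? = AllPairs.allPairs? (λ i j → ¬? (i ≟ j))

Injectiveʷ : Word d k → Set
Injectiveʷ σ = ∀ {i j} → lookup σ i ≡ lookup σ j → i ≡ j

unique⇒injective : {σ : Word d k} → Unique σ → Injectiveʷ σ
unique⇒injective u = lookup-injective u _ _

injective⇒unique : {σ : Word d k} → Injectiveʷ σ → Unique σ
injective⇒unique {σ = σ} inj = subst Unique (tabulate∘lookup σ) (tabulate⁺ inj)

unique-swap : ∀ (i j : Fin k) {σ : Word d k} → Unique σ → Unique (swap i j σ)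
unique-swap i j {σ} u = injective⇒unique λ {s} {t} eq → transpose-injective i j (unique⇒injective u
  (≡.trans (≡.sym (lookup-swap i j σ s)) (≡.trans eq (lookup-swap i j σ t))))

-- The junk value at an i that is not attained is i itself.
preimage : Word ν ν → Fin ν → Fin ν
preimage σ i with any? (λ j → lookup σ j ≟ i)
... | yes (j , _) = j
... | no _        = i

inverse : Word ν ν → Word ν ν
inverse σ = Vec.tabulate (preimage σ)

-- By the pigeonhole principle: if i were not attained, punching it out of the codomain would inject
-- `Fin (suc ν)` into `Fin ν`.
lookup-preimage : ∀ {σ : Word ν ν} → Unique σ → ∀ i → lookup σ (preimage σ i) ≡ i
lookup-preimage {ν = suc ν} {σ} u i with any? (λ j → lookup σ j ≟ i)
... | yes (_ , eq) = eq
... | no ¬∃ = contradiction (injective⇒≤ {f = λ j → punchOut (i≢ j)}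
                λ {j} {m} → unique⇒injective u ∘ punchOut-injective (i≢ j) (i≢ m)) ℕ.1+n≰n
  where
  i≢ : ∀ j → i ≢ lookup σ j
  i≢ j eq = ¬∃ (j , ≡.sym eq)

lookup-inverseʳ : ∀ {σ : Word ν ν} → Unique σ → ∀ i → lookup σ (lookup (inverse σ) i) ≡ i
lookup-inverseʳ {σ = σ} u i = ≡.trans (cong (lookup σ) (lookup∘tabulate (preimage σ) i)) (lookup-preimage u i)

lookup-inverseˡ : ∀ {σ : Word ν ν} → Unique σ → ∀ i → lookup (inverse σ) (lookup σ i) ≡ i
lookup-inverseˡ u i = unique⇒injective u (lookup-inverseʳ u _)

unique-inverse : {σ : Word ν ν} → Unique σ → Unique (inverse σ)
unique-inverse {σ = σ} u = injective⇒unique λ {i} {j} eq →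
  ≡.trans (≡.sym (lookup-inverseʳ u i)) (≡.trans (cong (lookup σ) eq) (lookup-inverseʳ u j))

unique-idʷ : ∀ ν → Unique (idʷ ν)
unique-idʷ ν = injective⇒unique λ {i} {j} eq → ≡.trans (≡.sym (lookup-allFin i)) (≡.trans eq (lookup-allFin j))

transpose-comm : ∀ (i j t : Fin ν) → transpose i j t ≡ transpose j i t
transpose-comm i j t = case t ≟ i of λ where
  (yes ≡.refl) → ≡.trans (transpose-left i j) (≡.sym (transpose-right j i))
  (no t≢i) → case t ≟ j of λ where
    (yes ≡.refl) → ≡.trans (transpose-right i j) (≡.sym (transpose-left j i))
    (no t≢j) → ≡.trans (transpose-other t≢i t≢j) (≡.sym (transpose-other t≢j t≢i))

swap-comm : ∀ (i j : Fin k) (q : Word d k) → swap i j q ≡ swap j i q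
swap-comm i j q = tabulate-cong λ t → cong (lookup q) (transpose-comm i j t)

-- Nothing lies strictly between adjacent positions, so their transposition reverses the order of
-- that one pair only. Signs are therefore computed for adjacent transpositions before general ones.
transpose-adjacent-< : ∀ {i j : Fin ν} → toℕ j ≡ suc (toℕ i) → ∀ {s t} → s Fin.< t →
                       ¬ (s ≡ i × t ≡ j) → transpose i j s Fin.< transpose i j t
transpose-adjacent-< {i = i} {j} j≡1+i {s} {t} s<t other = case s ≟ i of λ where
    (yes ≡.refl) →
      let t≢i = λ { ≡.refl → ℕ.n≮n _ s<t }
          t≢j = λ { ≡.refl → other (≡.refl , ≡.refl) }
      in subst₂′ (transpose-left i j) (transpose-other t≢i t≢j)
           (ℕ.≤∧≢⇒< (subst (ℕ._≤ toℕ t) (≡.sym j≡1+i) s<t) λ eq → t≢j (≡.sym (toℕ-injective eq)))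
    (no s≢i) → case s ≟ j of λ where
      (yes ≡.refl) →
        let i<t = ℕ.<-trans i<j s<t
            t≢i = λ { ≡.refl → ℕ.n≮n _ i<t }
            t≢j = λ { ≡.refl → ℕ.n≮n _ s<t }
        in subst₂′ (transpose-right i j) (transpose-other t≢i t≢j) i<t
      (no s≢j) → case t ≟ i of λ where
        (yes ≡.refl) → subst₂′ (transpose-other s≢i s≢j) (transpose-left i j) (ℕ.<-trans s<t i<j)
        (no t≢i) → case t ≟ j of λ where
          (yes ≡.refl) → subst₂′ (transpose-other s≢i s≢j) (transpose-right i j)
             (ℕ.≤∧≢⇒< (ℕ.≤-pred (subst (toℕ s ℕ.<_) j≡1+i s<t)) λ eq → s≢i (toℕ-injective eq))
          (no t≢j) → subst₂′ (transpose-other s≢i s≢j) (transpose-other t≢i t≢j) s<t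
  where
  i<j : i Fin.< j
  i<j = ℕ.≤-reflexive (≡.sym j≡1+i)
  subst₂′ : ∀ {x x′ y y′ : Fin _} → x ≡ x′ → y ≡ y′ → x′ Fin.< y′ → x Fin.< y
  subst₂′ ≡.refl ≡.refl lt = lt

-- Inversions are counted in ℤ to make the lemmas on finite sums over a ring available.
module Inversions where
  open FiniteSums ℤ.+-*-ring
  open Ring ℤ.+-*-ring using (setoid; _≈_; reflexive; +-cong; +-comm; _+_)
  open BigOps (Ring.rawRing ℤ.+-*-ring) using (∑)
  open import Relation.Binary.Reasoning.Setoid setoid

  +-length : (xs : List A) → + length xs ≈ ∑ xs λ _ → ℤ.1ℤ
  +-length []       = ≡.refl
  +-length (x ∷ xs) = cong (λ s → ℤ.1ℤ ℤ.+ s) (+-length xs)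

  inverted : Word ν ν → Fin ν → Fin ν → ℤ
  inverted σ i j = when (lookup σ j <? lookup σ i) ℤ.1ℤ

  inversions-∑ : (σ : Word ν ν) →
    + inversions σ ≈ ∑ (allFin ν) λ i → ∑ (allFin ν) λ j → when (i <? j) (inverted σ i j)
  inversions-∑ {ν} σ = begin
    + inversions σ ≈⟨ +-length (filter inv? (cartesianProduct (allFin ν) (allFin ν))) ⟩
    ∑ (filter inv? (cartesianProduct (allFin ν) (allFin ν))) (λ _ → ℤ.1ℤ)
      ≈⟨ ∑-filter inv? (cartesianProduct (allFin ν) (allFin ν)) (λ _ → ℤ.1ℤ) ⟩
    ∑ (cartesianProduct (allFin ν) (allFin ν)) (λ x → when (inv? x) ℤ.1ℤ)
      ≈⟨ ∑-cartesianProduct (allFin ν) (allFin ν) (λ x → when (inv? x) ℤ.1ℤ) ⟩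
    ∑ (allFin ν) (λ i → ∑ (allFin ν) λ j → when (inv? (i , j)) ℤ.1ℤ)
      ≈⟨ ∑-cong (allFin ν) (λ i → ∑-cong (allFin ν) λ j → when-× (i <? j) (lookup σ j <? lookup σ i)) ⟨
    ∑ (allFin ν) (λ i → ∑ (allFin ν) λ j → when (i <? j) (inverted σ i j)) ∎
    where
    inv? = λ ((i , j) : Fin ν × Fin ν) → (i <? j) ×-dec (lookup σ j <? lookup σ i)

  -- A pair (i , j) is inverted by σ exactly when (σ(j) , σ(i)) is inverted by the inverse, so both
  -- sums are reindexed by σ and then interchanged.
  inversions-inverse : {σ : Word ν ν} → Unique σ → inversions (inverse σ) ≡ inversions σ
  inversions-inverse {ν} {σ} u = ℤ.+-injective (begin
    + inversions τ
      ≈⟨ inversions-∑ τ ⟩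
    ∑ (allFin ν) (λ a → ∑ (allFin ν) λ b → when (a <? b) (inverted τ a b))
      ≈⟨ ∑-bijection δ δ (lookup σ) (lookup τ) (lookup-inverseˡ u) (lookup-inverseʳ u) (λ a → ∑ (allFin ν) λ b → when (a <? b) (inverted τ a b)) ⟨
    ∑ (allFin ν) (λ j → ∑ (allFin ν) λ b → when (lookup σ j <? b) (inverted τ (lookup σ j) b))
      ≈⟨ ∑-cong (allFin ν) (λ j → ∑-bijection δ δ (lookup σ) (lookup τ) (lookup-inverseˡ u) (lookup-inverseʳ u)
           (λ b → when (lookup σ j <? b) (inverted τ (lookup σ j) b))) ⟨
    ∑ (allFin ν) (λ j → ∑ (allFin ν) λ i →
      when (lookup σ j <? lookup σ i) (when (lookup τ (lookup σ i) <? lookup τ (lookup σ j)) ℤ.1ℤ))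
      ≈⟨ ∑-cong (allFin ν) (λ j → ∑-cong (allFin ν) λ i → begin
           when (lookup σ j <? lookup σ i) (when (lookup τ (lookup σ i) <? lookup τ (lookup σ j)) ℤ.1ℤ)
             ≡⟨ cong₂ (λ s t → when (lookup σ j <? lookup σ i) (when (s <? t) ℤ.1ℤ))
                  (lookup-inverseˡ u i) (lookup-inverseˡ u j) ⟩
           when (lookup σ j <? lookup σ i) (when (i <? j) ℤ.1ℤ)
             ≈⟨ when-when (lookup σ j <? lookup σ i) (i <? j) ⟩
           when (i <? j) (inverted σ i j) ∎) ⟩
    ∑ (allFin ν) (λ j → ∑ (allFin ν) λ i → when (i <? j) (inverted σ i j))
      ≈⟨ ∑-swap (allFin ν) (allFin ν) (λ j i → when (i <? j) (inverted σ i j)) ⟩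
    ∑ (allFin ν) (λ i → ∑ (allFin ν) λ j → when (i <? j) (inverted σ i j))
      ≈⟨ inversions-∑ σ ⟨
    + inversions σ ∎)
    where
    τ = inverse σ
    δ = enumerates-allFin ν
    when-when : ∀ {p q} {P : Set p} {Q : Set q} (d : Dec P) (e : Dec Q) {x} → when d (when e x) ≈ when e (when d x)
    when-when (yes _) e       = ≡.refl
    when-when (no _)  e       = ≡.sym (when-0 e)

  inversions-idʷ : ∀ ν → inversions (idʷ ν) ≡ 0
  inversions-idʷ ν = ℤ.+-injective (begin
    + inversions (idʷ ν)
      ≈⟨ inversions-∑ (idʷ ν) ⟩
    ∑ (allFin ν) (λ i → ∑ (allFin ν) λ j → when (i <? j) (inverted (idʷ ν) i j))
      ≈⟨ ∑-zero (allFin ν) (λ i → ∑-zero (allFin ν) λ j → ≡.trans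
           (when-cong (i <? j) λ i<j → when-no (lookup (idʷ ν) j <? lookup (idʷ ν) i)
             λ lt → ℕ.<-asym i<j (≡.subst₂ Fin._<_ (lookup-allFin j) (lookup-allFin i) lt))
           (when-0 (i <? j))) ⟩
    ℤ.0ℤ ∎)

  module _ {i j : Fin ν} (j≡1+i : toℕ j ≡ suc (toℕ i)) (σ : Word ν ν) where
    private
      τ = transpose i j
      δ = enumerates-allFin ν

      i<j : i Fin.< j
      i<j = ℕ.≤-reflexive (≡.sym j≡1+i)

      i≢j : i ≢ j
      i≢j = <⇒≢ i<j

      -- τ preserves the order of s < t except at the pairs (i , j) and (j , i). The two correction
      -- terms balance these pairs without any subtraction.
      compare : ∀ s t → when (τ s <? τ t) (inverted σ s t) + when ((s ≟ i) ×-dec (t ≟ j)) (inverted σ s t)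
                      ≈ when (s <? t) (inverted σ s t) + when ((s ≟ j) ×-dec (t ≟ i)) (inverted σ s t)
      compare s t = case (s ≟ i) ×-dec (t ≟ j) of λ where
        (yes (≡.refl , ≡.refl)) → ≡.trans (+-cong
            (when-no (τ i <? τ j) λ lt → ℕ.<-asym i<j (≡.subst₂ Fin._<_ (transpose-left i j) (transpose-right i j) lt))
            (when-yes ((i ≟ i) ×-dec (j ≟ j)) (≡.refl , ≡.refl)))
          (≡.trans (+-comm ℤ.0ℤ (inverted σ i j)) (≡.sym (+-cong (when-yes (i <? j) i<j)
            (when-no ((i ≟ j) ×-dec (j ≟ i)) (i≢j ∘ proj₁)))))
        (no ¬ij) → case (s ≟ j) ×-dec (t ≟ i) of λ where
          (yes (≡.refl , ≡.refl)) → ≡.trans (+-cong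
              (when-yes (τ j <? τ i) (≡.subst₂ Fin._<_ (≡.sym (transpose-right i j)) (≡.sym (transpose-left i j)) i<j))
              (when-no ((j ≟ i) ×-dec (i ≟ j)) (i≢j ∘ proj₂)))
            (≡.trans (+-comm (inverted σ j i) ℤ.0ℤ) (≡.sym (+-cong (when-no (j <? i) (ℕ.<-asym i<j))
              (when-yes ((j ≟ j) ×-dec (i ≟ i)) (≡.refl , ≡.refl)))))
          (no ¬ji) → +-cong
            (when-⇔ (τ s <? τ t) (s <? t)
              (λ lt → ≡.subst₂ Fin._<_ (transpose-involutive i j s) (transpose-involutive i j t)
                (transpose-adjacent-< j≡1+i lt λ (e , e′) → ¬ji
                  ( transpose-injective i j (≡.trans e (≡.sym (transpose-right i j)))
                  , transpose-injective i j (≡.trans e′ (≡.sym (transpose-left i j))))))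
              (λ lt → transpose-adjacent-< j≡1+i lt ¬ij))
            (≡.trans (when-no ((s ≟ i) ×-dec (t ≟ j)) ¬ij) (≡.sym (when-no ((s ≟ j) ×-dec (t ≟ i)) ¬ji)))

      ∑∑-δ : ∀ (f : Fin ν → Fin ν → ℤ) i j →
             ∑ (allFin ν) (λ s → ∑ (allFin ν) λ t → when ((s ≟ i) ×-dec (t ≟ j)) (f s t)) ≈ f i j
      ∑∑-δ f i j = begin
        ∑ (allFin ν) (λ s → ∑ (allFin ν) λ t → when ((s ≟ i) ×-dec (t ≟ j)) (f s t))
          ≈⟨ ∑-cong (allFin ν) (λ s → ∑-cong (allFin ν) λ t → when-× (s ≟ i) (t ≟ j)) ⟨
        ∑ (allFin ν) (λ s → ∑ (allFin ν) λ t → when (s ≟ i) (when (t ≟ j) (f s t)))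
          ≈⟨ ∑-cong (allFin ν) (λ s → ∑-when (allFin ν) (λ t → when (t ≟ j) (f s t)) (s ≟ i)) ⟩
        ∑ (allFin ν) (λ s → when (s ≟ i) (∑ (allFin ν) λ t → when (t ≟ j) (f s t)))
          ≈⟨ ∑-δ-allFin ν _ i ⟩
        ∑ (allFin ν) (λ t → when (t ≟ j) (f i t))
          ≈⟨ ∑-δ-allFin ν _ j ⟩
        f i j ∎

      ∑∑-+ : ∀ (f g : Fin ν → Fin ν → ℤ) →
             ∑ (allFin ν) (λ s → ∑ (allFin ν) λ t → f s t + g s t) ≈
             ∑ (allFin ν) (λ s → ∑ (allFin ν) λ t → f s t) + ∑ (allFin ν) (λ s → ∑ (allFin ν) λ t → g s t)
      ∑∑-+ f g = ≡.trans (∑-cong (allFin ν) λ s → ∑-+ (allFin ν) (f s) (g s))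
                         (∑-+ (allFin ν) (λ s → ∑ (allFin ν) (f s)) (λ s → ∑ (allFin ν) (g s)))

    -- Reindexing by τ turns the inversions of the swapped word into those of σ with s < t replaced
    -- by τ(s) < τ(t), to which `compare` applies. For a permutation exactly one of the two extra
    -- terms is 1, so the count changes by one.
    inversions-swap : + inversions (swap i j σ) + inverted σ i j ≈ + inversions σ + inverted σ j i
    inversions-swap = begin
      + inversions (swap i j σ) + inverted σ i j
        ≈⟨ +-cong (begin
          + inversions (swap i j σ)
            ≈⟨ inversions-∑ (swap i j σ) ⟩
          ∑ (allFin ν) (λ s → ∑ (allFin ν) λ t → when (s <? t) (inverted (swap i j σ) s t))
            ≈⟨ ∑-involution δ τ (transpose-involutive i j)
                 (λ s → ∑ (allFin ν) λ t → when (s <? t) (inverted (swap i j σ) s t)) ⟨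
          ∑ (allFin ν) (λ s → ∑ (allFin ν) λ t → when (τ s <? t) (inverted (swap i j σ) (τ s) t))
            ≈⟨ ∑-cong (allFin ν) (λ s → ∑-involution δ τ (transpose-involutive i j)
                 (λ t → when (τ s <? t) (inverted (swap i j σ) (τ s) t))) ⟨
          ∑ (allFin ν) (λ s → ∑ (allFin ν) λ t → when (τ s <? τ t) (inverted (swap i j σ) (τ s) (τ t)))
            ≈⟨ ∑-cong (allFin ν) (λ s → ∑-cong (allFin ν) λ t →
                 reflexive (cong₂ (λ x y → when (τ s <? τ t) (when (y <? x) ℤ.1ℤ)) (unswap s) (unswap t))) ⟩
          ∑ (allFin ν) (λ s → ∑ (allFin ν) λ t → when (τ s <? τ t) (inverted σ s t)) ∎)
          (≡.sym (∑∑-δ (inverted σ) i j)) ⟩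
      ∑ (allFin ν) (λ s → ∑ (allFin ν) λ t → when (τ s <? τ t) (inverted σ s t)) +
      ∑ (allFin ν) (λ s → ∑ (allFin ν) λ t → when ((s ≟ i) ×-dec (t ≟ j)) (inverted σ s t))
        ≈⟨ ∑∑-+ (λ s t → when (τ s <? τ t) (inverted σ s t))
             (λ s t → when ((s ≟ i) ×-dec (t ≟ j)) (inverted σ s t)) ⟨
      ∑ (allFin ν) (λ s → ∑ (allFin ν) λ t →
        when (τ s <? τ t) (inverted σ s t) + when ((s ≟ i) ×-dec (t ≟ j)) (inverted σ s t))
        ≈⟨ ∑-cong (allFin ν) (λ s → ∑-cong (allFin ν) (compare s)) ⟩
      ∑ (allFin ν) (λ s → ∑ (allFin ν) λ t →
        when (s <? t) (inverted σ s t) + when ((s ≟ j) ×-dec (t ≟ i)) (inverted σ s t))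
        ≈⟨ ∑∑-+ (λ s t → when (s <? t) (inverted σ s t))
             (λ s t → when ((s ≟ j) ×-dec (t ≟ i)) (inverted σ s t)) ⟩
      ∑ (allFin ν) (λ s → ∑ (allFin ν) λ t → when (s <? t) (inverted σ s t)) +
      ∑ (allFin ν) (λ s → ∑ (allFin ν) λ t → when ((s ≟ j) ×-dec (t ≟ i)) (inverted σ s t))
        ≈⟨ +-cong (≡.sym (inversions-∑ σ)) (∑∑-δ (inverted σ) j i) ⟩
      + inversions σ + inverted σ j i ∎
      where
      unswap : ∀ t → lookup (swap i j σ) (τ t) ≡ lookup σ t
      unswap t = ≡.trans (lookup-swap i j σ (τ t)) (cong (lookup σ) (transpose-involutive i j t))

    inversions-swap-adjacent : Unique σ →
      suc (inversions (swap i j σ)) ≡ inversions σ ⊎ inversions (swap i j σ) ≡ suc (inversions σ)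
    inversions-swap-adjacent u with <-cmp (lookup σ i) (lookup σ j)
    ... | tri< σi<σj _ σj≮σi = inj₂ (ℤ.+-injective (begin
      + inversions (swap i j σ)
        ≡⟨ ℤ.+-identityʳ _ ⟨
      + inversions (swap i j σ) ℤ.+ ℤ.0ℤ
        ≡⟨ cong (λ s → + inversions (swap i j σ) ℤ.+ s) (when-no (lookup σ j <? lookup σ i) σj≮σi) ⟨
      + inversions (swap i j σ) ℤ.+ inverted σ i j
        ≡⟨ inversions-swap ⟩
      + inversions σ ℤ.+ inverted σ j i
        ≡⟨ cong (λ s → + inversions σ ℤ.+ s) (when-yes (lookup σ i <? lookup σ j) σi<σj) ⟩
      + inversions σ ℤ.+ ℤ.1ℤ
        ≡⟨ ℤ.+-comm (+ inversions σ) ℤ.1ℤ ⟩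
      + suc (inversions σ) ∎))
    ... | tri≈ _ σi≡σj _ = contradiction (unique⇒injective u σi≡σj) i≢j
    ... | tri> σi≮σj _ σj<σi = inj₁ (ℤ.+-injective (begin
      + suc (inversions (swap i j σ))
        ≡⟨ ℤ.+-comm ℤ.1ℤ (+ inversions (swap i j σ)) ⟩
      + inversions (swap i j σ) ℤ.+ ℤ.1ℤ
        ≡⟨ cong (λ s → + inversions (swap i j σ) ℤ.+ s) (when-yes (lookup σ j <? lookup σ i) σj<σi) ⟨
      + inversions (swap i j σ) ℤ.+ inverted σ i j
        ≡⟨ inversions-swap ⟩
      + inversions σ ℤ.+ inverted σ j i
        ≡⟨ cong (λ s → + inversions σ ℤ.+ s) (when-no (lookup σ i <? lookup σ j) σi≮σj) ⟩
      + inversions σ ℤ.+ ℤ.0ℤ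
        ≡⟨ ℤ.+-identityʳ _ ⟩
      + inversions σ ∎))

module SignRow (𝓡 : Ring c ℓ) (n : ℕ) where
  open Ring 𝓡 hiding (zero)
  open BigOps rawRing
  open FiniteSums 𝓡
  open import Relation.Binary.Reasoning.Setoid setoid
  open Tensor n n rawRing
  open RowVectors 𝓡 n n

  sgn-swap : ∀ {i j : Fin n} → toℕ j ≡ suc (toℕ i) → ∀ {σ} → Unique σ → sgn (swap i j σ) ≈ - sgn σ
  sgn-swap {i} {j} j≡1+i {σ} u with Inversions.inversions-swap-adjacent j≡1+i σ u
  ... | inj₁ eq = begin
    sgn (swap i j σ)                            ≈⟨ -‿involutive _ ⟨
    - (- sgn (swap i j σ))                      ≈⟨ -‿cong (-1*x≈-x _) ⟨
    - (- 1# * (- 1#) ^ inversions (swap i j σ)) ≡⟨ cong (λ m → - (- 1#) ^ m) eq ⟩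
    - sgn σ                                     ∎
  ... | inj₂ eq = begin
    (- 1#) ^ inversions (swap i j σ) ≡⟨ cong ((- 1#) ^_) eq ⟩
    - 1# * sgn σ                     ≈⟨ -1*x≈-x _ ⟩
    - sgn σ                          ∎

  signRow : Row
  signRow σ = when (unique? σ) (sgn σ)

  signRow-adjacent : ∀ {i j : Fin n} → toℕ j ≡ suc (toℕ i) → ∀ σ → signRow (swap i j σ) ≈ - signRow σ
  signRow-adjacent {i} {j} j≡1+i σ = begin
    when (unique? (swap i j σ)) (sgn (swap i j σ))
      ≈⟨ when-⇔ (unique? (swap i j σ)) (unique? σ)
           (λ u → subst Unique (swap-involutive i j σ) (unique-swap i j u)) (unique-swap i j) ⟩
    when (unique? σ) (sgn (swap i j σ)) ≈⟨ when-cong (unique? σ) (sgn-swap j≡1+i) ⟩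
    when (unique? σ) (- sgn σ)          ≈⟨ when-neg (unique? σ) ⟩
    - signRow σ                         ∎

  -- Induction on the distance of i and j: with h = j - 1 one has (i j) = (h j)(i h)(h j), which
  -- makes three changes of sign.
  signRow-< : ∀ m {i j : Fin n} → toℕ j ≡ suc m ℕ.+ toℕ i → ∀ σ → signRow (swap i j σ) ≈ - signRow σ
  signRow-< zero    j≡ σ = signRow-adjacent j≡ σ
  signRow-< (suc m) {i} {j} j≡ σ = begin
    signRow (swap i j σ)                       ≡⟨ cong signRow conj ⟨
    signRow (swap h j (swap i h (swap h j σ))) ≈⟨ signRow-adjacent j≡1+h (swap i h (swap h j σ)) ⟩
    - signRow (swap i h (swap h j σ))          ≈⟨ -‿cong (signRow-< m h≡ (swap h j σ)) ⟩
    - (- signRow (swap h j σ))                 ≈⟨ -‿involutive _ ⟩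
    signRow (swap h j σ)                       ≈⟨ signRow-adjacent j≡1+h σ ⟩
    - signRow σ                                ∎
    where
    h<n : suc m ℕ.+ toℕ i ℕ.< n
    h<n = ℕ.<-trans (ℕ.≤-reflexive (≡.sym j≡)) (toℕ<n j)
    h : Fin n
    h = Fin.fromℕ< h<n
    h≡ : toℕ h ≡ suc m ℕ.+ toℕ i
    h≡ = toℕ-fromℕ< h<n
    j≡1+h : toℕ j ≡ suc (toℕ h)
    j≡1+h = ≡.trans j≡ (cong suc (≡.sym h≡))
    i≢h : i ≢ h
    i≢h i≡h = ℕ.n≮n (toℕ i) (ℕ.<-≤-trans (s≤s (ℕ.m≤n+m (toℕ i) m)) (ℕ.≤-reflexive (≡.trans (≡.sym h≡) (cong toℕ (≡.sym i≡h)))))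
    i≢j : i ≢ j
    i≢j i≡j = ℕ.n≮n (toℕ i) (ℕ.<-≤-trans (s≤s (ℕ.m≤n+m (toℕ i) (suc m))) (ℕ.≤-reflexive (≡.trans (≡.sym j≡) (cong toℕ (≡.sym i≡j)))))
    conj : swap h j (swap i h (swap h j σ)) ≡ swap i j σ
    conj = lookup-ext λ t → ≡.trans (lookup-swap h j (swap i h (swap h j σ)) t)
      (≡.trans (lookup-swap i h (swap h j σ) (transpose h j t))
      (≡.trans (lookup-swap h j σ (transpose i h (transpose h j t)))
      (≡.trans (cong (lookup σ) (≡.trans
         (≡.sym (transpose-conj (transpose-injective h j) i h (transpose h j t)))
         (≡.trans (cong₂ (λ x y → transpose x y (transpose h j (transpose h j t)))
                    (transpose-other i≢h i≢j) (transpose-left h j))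
                  (cong (transpose i j) (transpose-involutive h j t)))))
      (≡.sym (lookup-swap i j σ t)))))

  private
    gap : ∀ {i j : Fin n} → i Fin.< j → toℕ j ≡ suc (toℕ j ∸ suc (toℕ i)) ℕ.+ toℕ i
    gap {i} {j} i<j = ≡.trans (≡.sym (ℕ.m∸n+n≡m i<j)) (ℕ.+-suc (toℕ j ∸ suc (toℕ i)) (toℕ i))

  signRow-alternating : Alternating≥ 0 signRow
  signRow-alternating {i} {j} _ _ i≢j σ with <-cmp i j
  ... | tri≈ _ i≡j _ = contradiction i≡j i≢j
  ... | tri< i<j _ _ = signRow-< _ (gap i<j) σ
  ... | tri> _ _ j<i = trans (reflexive (cong signRow (swap-comm i j σ))) (signRow-< _ (gap j<i) σ)

  signRow-idʷ : signRow (idʷ n) ≈ 1#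
  signRow-idʷ = trans (when-yes (unique? (idʷ n)) (unique-idʷ n))
    (reflexive (cong ((- 1#) ^_) (Inversions.inversions-idʷ n)))

  -- The only permutation contributing at column q is the inverse of q, and it has as many
  -- inversions as q. If q has a repeated letter, nothing contributes.
  Antisym-idʷ : ∀ q → Antisym (idʷ n) q ≈ signRow q
  Antisym-idʷ q = begin
    ∑ (permutations n) (λ σ → when (idʷ n ≟ʷ (q ∘ʷ σ)) (sgn σ))
      ≈⟨ ∑-filter unique? (words n n) (λ σ → when (idʷ n ≟ʷ (q ∘ʷ σ)) (sgn σ)) ⟩
    ∑ (words n n) (λ σ → when (unique? σ) (when (idʷ n ≟ʷ (q ∘ʷ σ)) (sgn σ)))
      ≈⟨ ∑-cong (words n n) (λ σ → trans (when-× (unique? σ) (idʷ n ≟ʷ (q ∘ʷ σ)))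
           (trans (when-⇔ (unique? σ ×-dec (idʷ n ≟ʷ (q ∘ʷ σ))) ((σ ≟ʷ inverse q) ×-dec unique? q) (to σ) (from σ))
             (sym (when-× (σ ≟ʷ inverse q) (unique? q))))) ⟩
    ∑ (words n n) (λ σ → when (σ ≟ʷ inverse q) (when (unique? q) (sgn σ)))
      ≈⟨ ∑-δ-words n n (λ σ → when (unique? q) (sgn σ)) (inverse q) ⟩
    when (unique? q) (sgn (inverse q))
      ≈⟨ when-cong (unique? q) (λ u → reflexive (cong ((- 1#) ^_) (Inversions.inversions-inverse u))) ⟩
    signRow q ∎
    where
    lookup-∘ʷ : ∀ σ i → lookup (q ∘ʷ σ) i ≡ lookup q (lookup σ i)
    lookup-∘ʷ σ i = lookup-map i (lookup q) σ
    to : ∀ σ → Unique σ × idʷ n ≡ q ∘ʷ σ → σ ≡ inverse q × Unique q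
    to σ (u , eq) = lookup-ext (λ i → unique⇒injective u-q
        (≡.trans (q∘σ i) (≡.sym (lookup-inverseʳ u-q i)))) , u-q
      where
      q∘σ : ∀ i → lookup q (lookup σ i) ≡ i
      q∘σ i = ≡.trans (≡.sym (lookup-∘ʷ σ i)) (≡.trans (cong (λ w → lookup w i) (≡.sym eq)) (lookup-allFin i))
      σ⁻¹ : ∀ i → lookup q i ≡ lookup (inverse σ) i
      σ⁻¹ i = ≡.trans (cong (lookup q) (≡.sym (lookup-inverseʳ u i))) (q∘σ (lookup (inverse σ) i))
      u-q : Unique q
      u-q = subst Unique (lookup-ext λ i → ≡.sym (σ⁻¹ i)) (unique-inverse u)
    from : ∀ σ → σ ≡ inverse q × Unique q → Unique σ × idʷ n ≡ q ∘ʷ σ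
    from σ (≡.refl , u) = unique-inverse u , lookup-ext λ i →
      ≡.trans (lookup-allFin i) (≡.sym (≡.trans (lookup-∘ʷ (inverse q) i) (lookup-inverseʳ u i)))

-- Expansion of the Sklyanin determinant over I_n and S(η)

module SlotProducts (𝓡 : Ring c ℓ) (d k : ℕ) where
  open Ring 𝓡 hiding (zero)
  open BigOps rawRing
  open FiniteSums 𝓡
  open import Relation.Binary.Reasoning.Setoid setoid
  open Tensor d k rawRing
  private
    module T = RawRing (End^⊗ d k rawRing)
    module TOps = BigOps (End^⊗ d k rawRing)

  slotProduct : (Fin ν → Fin d → Fin d → Carrier) → Word k ν → T.Carrier
  slotProduct {ν = ν} B η = TOps.∏ (allFin ν) λ m → B m at lookup η m

  slotProduct-suc : ∀ (B : Fin (suc ν) → Fin d → Fin d → Carrier) s η →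
                    slotProduct B (s ∷ η) ≡ (B zero at s) T.* slotProduct (B ∘ suc) η
  slotProduct-suc B s η =
    cong ((B zero at s) T.*_) (foldr-tabulate T._*_ T.1# suc (λ m → B m at lookup (s ∷ η) m))

  slotProduct-fixed : ∀ (B : Fin ν → Fin d → Fin d → Carrier) η {s} → (∀ m → lookup η m ≢ s) →
                      ∀ {p q} → lookup p s ≢ lookup q s → slotProduct B η p q ≈ 0#
  slotProduct-fixed B []       s∉η {p} {q} ps≢qs = when-no (p ≟ʷ q) λ p≡q → ps≢qs (cong (λ w → lookup w _) p≡q)
  slotProduct-fixed B (t ∷ η) {s} s∉η {p} {q} ps≢qs = begin
    slotProduct B (t ∷ η) p q
      ≡⟨ cong (λ X → X p q) (slotProduct-suc B t η) ⟩
    ∑ (words d k) (λ r → (B zero at t) p r * slotProduct (B ∘ suc) η r q)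
      ≈⟨ ∑-zero (words d k) (λ r → case lookup p s ≟ lookup r s of λ where
           (yes ps≡rs) → trans (*-congˡ (slotProduct-fixed (B ∘ suc) η (s∉η ∘ suc) λ rs≡qs → ps≢qs (≡.trans ps≡rs rs≡qs))) (zeroʳ _)
           (no ps≢rs)  → trans (*-congʳ (when-no (all? λ m → (m ≟ t) ⊎-dec (lookup p m ≟ lookup r m))
                           λ agree → [ (λ s≡t → s∉η zero (≡.sym s≡t)) , ps≢rs ] (agree s))) (zeroˡ _)) ⟩
    0# ∎

module SdetFormula (𝓡 : Ring c ℓ) (n : ℕ)
  (c : ℕ → Ring.Carrier 𝓡) (central-c : ∀ N → Central 𝓡 (c N))
  (c-suc : IsReciprocal 𝓡 c)
  (B : Fin n → Fin n → Fin n → Ring.Carrier 𝓡) where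
  open Ring 𝓡 hiding (zero)
  open BigOps rawRing
  open FiniteSums 𝓡
  open CentralElements 𝓡
  open import Relation.Binary.Reasoning.Setoid setoid
  open Tensor n n rawRing
  open RowVectors 𝓡 n n
  open Contraction c central-c c-suc
  open SignRow 𝓡 n
  open SlotProducts 𝓡 n n
  private
    module T = RawRing (End^⊗ n n rawRing)
    module TOps = BigOps (End^⊗ n n rawRing)

  bracket : T.Carrier
  bracket = TOps.∏ (allFin n) λ i → (B i at i) T.* TOps.∏ (filter (i <?_) (allFin n)) (R i)

  rises : Word n n → Carrier
  rises η = ∏ (filter (λ i → i <? lookup η i) (allFin n)) λ i → c (pos i ℕ.+ n ∸ 2)

  central-∏ : ∀ (xs : List A) {f : A → Carrier} → (∀ x → Central 𝓡 (f x)) → Central 𝓡 (∏ xs f)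
  central-∏ []       cf = central-1
  central-∏ (x ∷ xs) cf = central-* (cf x) (central-∏ xs cf)

  central-rises : ∀ η → Central 𝓡 (rises η)
  central-rises η = central-∏ (filter (λ i → i <? lookup η i) (allFin n)) λ i → central-c (pos i ℕ.+ n ∸ 2)

  ∏-zero : ∀ {xs : List A} {x} {f : A → Carrier} → x ∈ xs → f x ≈ 0# → ∏ xs f ≈ 0#
  ∏-zero (here ≡.refl) fx≈0 = trans (*-congʳ fx≈0) (zeroˡ _)
  ∏-zero (there x∈xs)  fx≈0 = trans (*-congˡ (∏-zero x∈xs fx≈0)) (zeroʳ _)

  -- The weight in the form suited to `I` and `α`. Its index `toℕ i ℕ.+ n ∸ 1` and the index
  -- `pos i ℕ.+ n ∸ 2` agree by computation.
  weight-≤ : ∀ i j → weight i j ≈ when (i ≤? j) (if does (i <? j) then c (pos i ℕ.+ n ∸ 2) else 1#)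
  weight-≤ i j with <-cmp i j
  ... | tri< i<j i≢j _ = begin
    weight i j ≈⟨ +-cong (when-no (j ≟ i) (≢-sym i≢j)) (when-yes (i <? j) i<j) ⟩
    0# + x     ≈⟨ +-identityˡ x ⟩
    x          ≡⟨ cong (if_then x else 1#) (dec-true (i <? j) i<j) ⟨
    (if does (i <? j) then x else 1#) ≈⟨ when-yes (i ≤? j) (ℕ.<⇒≤ i<j) ⟨
    when (i ≤? j) (if does (i <? j) then x else 1#) ∎
    where
    x = c (pos i ℕ.+ n ∸ 2)
  ... | tri≈ i≮j ≡.refl _ = begin
    weight i i ≈⟨ +-cong (when-yes (i ≟ i) ≡.refl) (when-no (i <? i) i≮j) ⟩
    1# + 0#    ≈⟨ +-identityʳ 1# ⟩
    1#         ≡⟨ cong (if_then x else 1#) (dec-false (i <? i) i≮j) ⟨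
    (if does (i <? i) then x else 1#) ≈⟨ when-yes (i ≤? i) ℕ.≤-refl ⟨
    when (i ≤? i) (if does (i <? i) then x else 1#) ∎
    where
    x = c (pos i ℕ.+ n ∸ 2)
  ... | tri> i≮j i≢j j<i = begin
    weight i j ≈⟨ +-cong (when-no (j ≟ i) (≢-sym i≢j)) (when-no (i <? j) i≮j) ⟩
    0# + 0#    ≈⟨ +-identityˡ 0# ⟩
    0#         ≈⟨ when-no (i ≤? j) (ℕ.<⇒≱ j<i) ⟨
    when (i ≤? j) _ ∎

  -- A word outside I_n has some letter η_i < i, whose weight is zero. Inside I_n the letters η_i =
  -- i have weight 1, and only the rises remain.
  ∏-weight : ∀ η → ∏ (allFin n) (λ i → weight i (lookup η i)) ≈ when (all? λ i → i ≤? lookup η i) (rises η)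
  ∏-weight η = begin
    ∏ (allFin n) (λ i → weight i (lookup η i))
      ≈⟨ ∏-cong (allFin n) (λ i → weight-≤ i (lookup η i)) ⟩
    ∏ (allFin n) (λ i → when (i ≤? lookup η i) (x i))
      ≈⟨ case all? (λ i → i ≤? lookup η i) of (λ where
           (yes ∀≤) → trans (∏-cong (allFin n) λ i → when-yes (i ≤? lookup η i) (∀≤ i))
                            (sym (when-yes (all? λ i → i ≤? lookup η i) ∀≤))
           (no ¬∀≤) → let i , i≰ = Fin.¬∀⟶∃¬ n _ (λ i → i ≤? lookup η i) ¬∀≤ in
                      trans (∏-zero (∈-allFin i) (when-no (i ≤? lookup η i) i≰))
                            (sym (when-no (all? λ i → i ≤? lookup η i) ¬∀≤))) ⟩
    when (all? λ i → i ≤? lookup η i) (∏ (allFin n) x)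
      ≈⟨ when-cong (all? λ i → i ≤? lookup η i) (λ _ → ∏-filter (λ i → i <? lookup η i) (allFin n) _) ⟨
    when (all? λ i → i ≤? lookup η i) (rises η) ∎
    where
    x : Fin n → Carrier
    x i = if does (i <? lookup η i) then c (pos i ℕ.+ n ∸ 2) else 1#

  -- The signature restricts the rows to permutations. As the column is the identity word,
  -- `slotProduct-fixed` kills each permutation that moves a point outside the image of η.
  signRow-slotProduct : ∀ η → (signRow ⋆ slotProduct B η) (idʷ n) ≈
                        ∑ (S η) λ σ → sgn σ * slotProduct B η σ (idʷ n)
  signRow-slotProduct η = begin
    ∑ (words n n) (λ σ → when (unique? σ) (sgn σ) * slotProduct B η σ (idʷ n))
      ≈⟨ ∑-cong (words n n) (λ σ → trans (when-* (unique? σ)) (when-cong (unique? σ) λ _ → support σ)) ⟩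
    ∑ (words n n) (λ σ → when (unique? σ) (when (fixes? σ) (sgn σ * slotProduct B η σ (idʷ n))))
      ≈⟨ ∑-filter unique? (words n n) (λ σ → when (fixes? σ) (sgn σ * slotProduct B η σ (idʷ n))) ⟨
    ∑ (permutations n) (λ σ → when (fixes? σ) (sgn σ * slotProduct B η σ (idʷ n)))
      ≈⟨ ∑-filter fixes? (permutations n) (λ σ → sgn σ * slotProduct B η σ (idʷ n)) ⟨
    ∑ (S η) (λ σ → sgn σ * slotProduct B η σ (idʷ n)) ∎
    where
    fixes? : ∀ σ → Dec (∀ i → ∃ (λ m → lookup η m ≡ i) ⊎ lookup σ i ≡ i)
    fixes? σ = all? λ i → ∈Im? η i ⊎-dec (lookup σ i ≟ i)
    support : ∀ σ → sgn σ * slotProduct B η σ (idʷ n) ≈ when (fixes? σ) (sgn σ * slotProduct B η σ (idʷ n))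
    support σ = case fixes? σ of λ where
      (yes fixes) → sym (when-yes (fixes? σ) fixes)
      (no ¬fixes) → let i , ¬i = Fin.¬∀⟶∃¬ n _ (λ i → ∈Im? η i ⊎-dec (lookup σ i ≟ i)) ¬fixes in
        trans (trans (*-congˡ (slotProduct-fixed B η (λ m ηm≡i → ¬i (inj₁ (m , ηm≡i)))
                 λ σi≡ → ¬i (inj₂ (≡.trans σi≡ (lookup-allFin i))))) (zeroʳ _))
              (sym (when-no (fixes? σ) ¬fixes))

  sdet-formula : ∀ s → (Antisym T.* bracket) T.≈ (s • Antisym) →
    s ≈ ∑ (I n) λ η → ∑ (S η) λ σ → (sgn σ * rises η) * slotProduct B η σ (idʷ n)
  sdet-formula s isSdet = begin
    s
      ≈⟨ *-identityʳ s ⟨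
    s * 1#
      ≈⟨ *-congˡ (trans (Antisym-idʷ (idʷ n)) signRow-idʷ) ⟨
    s * Antisym (idʷ n) (idʷ n)
      ≈⟨ isSdet (idʷ n) (idʷ n) ⟨
    (Antisym (idʷ n) ⋆ bracket) (idʷ n)
      ≈⟨ ⋆-congˡ bracket Antisym-idʷ (idʷ n) ⟩
    (signRow ⋆ bracket) (idʷ n)
      ≈⟨ expand n 0 id (λ _ → ≡.refl) B (λ {i} {j} → signRow-alternating {i} {j}) (idʷ n) ⟩
    ∑ (words n n) (λ η → ∏ (allFin n) (λ i → weight i (lookup η i)) * (signRow ⋆ slotProduct B η) (idʷ n))
      ≈⟨ ∑-cong (words n n) (λ η → trans (*-congʳ (∏-weight η))
           (trans (when-* (all? λ i → i ≤? lookup η i)) (when-cong (all? λ i → i ≤? lookup η i) λ _ → begin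
             rises η * (signRow ⋆ slotProduct B η) (idʷ n)
               ≈⟨ *-congˡ (signRow-slotProduct η) ⟩
             rises η * ∑ (S η) (λ σ → sgn σ * slotProduct B η σ (idʷ n))
               ≈⟨ *-∑ (S η) _ (rises η) ⟩
             ∑ (S η) (λ σ → rises η * (sgn σ * slotProduct B η σ (idʷ n)))
               ≈⟨ ∑-cong (S η) (λ σ → trans (sym (*-assoc _ _ _)) (*-congʳ (central-rises η (sgn σ)))) ⟩
             ∑ (S η) (λ σ → (sgn σ * rises η) * slotProduct B η σ (idʷ n)) ∎))) ⟩
    ∑ (words n n) (λ η → when (all? λ i → i ≤? lookup η i)
      (∑ (S η) λ σ → (sgn σ * rises η) * slotProduct B η σ (idʷ n)))
      ≈⟨ ∑-filter (λ η → all? λ i → i ≤? lookup η i) (words n n) _ ⟨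
    ∑ (I n) (λ η → ∑ (S η) λ σ → (sgn σ * rises η) * slotProduct B η σ (idʷ n)) ∎

-- Paths and the combinatorics of η

-- A path assigns to each factor the index that it writes into its tensor
-- slot; the slot starts with the entry of p.
final : Word k ν → Word d ν → Word d k → Word d k
final []      []       p = p
final (N ∷ η) (x ∷ xs) p = final η xs (p [ N ]≔ x)

-- The row index of factor m: the latest letter in its slot, or the initial letter of p if no
-- earlier factor has used that slot.
incoming : Word k ν → Word d ν → Word d k → Fin ν → Fin d
incoming (N ∷ η) (x ∷ xs) p zero    = lookup p N
incoming (N ∷ η) (x ∷ xs) p (suc m) = incoming η xs (p [ N ]≔ x) m

module _ (η : Word k ν) where

  IsFirst IsLast : Fin ν → Set
  IsFirst t = ∀ j → j Fin.< t → lookup η j ≢ lookup η t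
  IsLast  t = ∀ j → t Fin.< j → lookup η j ≢ lookup η t

  -- The predecessor relation within a fibre of η, phrased by the order alone so that it restricts
  -- to tails of η.
  record Next (j t : Fin ν) : Set where
    constructor next
    field
      before  : j Fin.< t
      same    : lookup η j ≡ lookup η t
      between : ∀ i → j Fin.< i → i Fin.< t → lookup η i ≢ lookup η t

final-∉ : ∀ (η : Word k ν) (x : Word d ν) p {N} → (∀ m → lookup η m ≢ N) → lookup (final η x p) N ≡ lookup p N
final-∉ []      []       p N∉η = ≡.refl
final-∉ (M ∷ η) (x ∷ xs) p N∉η =
  ≡.trans (final-∉ η xs (p [ M ]≔ x) (N∉η ∘ suc)) (lookup∘update′ (≢-sym (N∉η zero)) p x)

final-last : ∀ (η : Word k ν) (x : Word d ν) p {m} → IsLast η m → lookup (final η x p) (lookup η m) ≡ lookup x m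
final-last (M ∷ η) (x ∷ xs) p {zero}  l =
  ≡.trans (final-∉ η xs (p [ M ]≔ x) λ m → l (suc m) (s≤s z≤n)) (lookup∘update M p x)
final-last (M ∷ η) (x ∷ xs) p {suc m} l = final-last η xs (p [ M ]≔ x) λ j m<j → l (suc j) (s≤s m<j)

incoming-first : ∀ (η : Word k ν) (x : Word d ν) p {m} → IsFirst η m → incoming η x p m ≡ lookup p (lookup η m)
incoming-first (M ∷ η) (x ∷ xs) p {zero}  f = ≡.refl
incoming-first (M ∷ η) (x ∷ xs) p {suc m} f =
  ≡.trans (incoming-first η xs (p [ M ]≔ x) λ j j<m → f (suc j) (s≤s j<m))
          (lookup∘update′ (≢-sym (f zero (s≤s z≤n))) p x)

incoming-next : ∀ (η : Word k ν) (x : Word d ν) p {j m} → Next η j m → incoming η x p m ≡ lookup x j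
incoming-next (M ∷ η) (x ∷ xs) p {zero}  {suc m} (next _ ≡.refl b) =
  ≡.trans (incoming-first η xs (p [ M ]≔ x) λ i i<m → b (suc i) (s≤s z≤n) (s≤s i<m)) (lookup∘update M p x)
incoming-next (M ∷ η) (x ∷ xs) p {suc j} {suc m} (next (s≤s j<m) e b) =
  incoming-next η xs (p [ M ]≔ x) (next j<m e λ i j<i i<m → b (suc i) (s≤s j<i) (s≤s i<m))

module Paths (𝓡 : Ring c ℓ) (d k : ℕ) where
  open Ring 𝓡 hiding (zero)
  open BigOps rawRing
  open FiniteSums 𝓡
  open import Relation.Binary.Reasoning.Setoid setoid
  open Tensor d k rawRing
  open SlotProducts 𝓡 d k
  private
    module T = RawRing (End^⊗ d k rawRing)

  -- A nonzero entry of `M at s` has row and column equal outside s, so the intermediate word is p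
  -- with a single letter x rewritten.
  at-* : ∀ M s X p q → ((M at s) T.* X) p q ≈
         ∑ (allFin d) λ x → M (lookup p s) x * X (p [ s ]≔ x) q
  at-* M s X p q = begin
    ∑ (words d k) (λ r → when (agree? r) (M (lookup p s) (lookup r s)) * X r q)
      ≈⟨ ∑-cong (words d k) (λ r → trans (when-* (agree? r)) (when-cong (agree? r) λ agree →
           *-congˡ (reflexive (cong (λ r → X r q) (agree⇒update r agree))))) ⟩
    ∑ (words d k) (λ r → when (agree? r) (f (lookup r s)))
      ≈⟨ reindex (enumerates-words d k) (enumerates-allFin d) {Q = λ _ → ⊤} agree? (λ _ → yes tt)
           (λ r → lookup r s) (λ x → p [ s ]≔ x)
           (λ r agree → tt , agree⇒update r agree)
           (λ x _ → update-agrees x , ≡.sym (lookup∘update s p x)) f ⟩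
    ∑ (allFin d) f ∎
    where
    f : Fin d → Carrier
    f x = M (lookup p s) x * X (p [ s ]≔ x) q
    agree? : ∀ r → Dec (∀ t → t ≡ s ⊎ lookup p t ≡ lookup r t)
    agree? r = all? λ t → (t ≟ s) ⊎-dec (lookup p t ≟ lookup r t)
    agree⇒update : ∀ r → (∀ t → t ≡ s ⊎ lookup p t ≡ lookup r t) → r ≡ p [ s ]≔ lookup r s
    agree⇒update r agree = lookup-ext λ t → case t ≟ s of λ where
      (yes ≡.refl) → ≡.sym (lookup∘update s p _)
      (no t≢s) → [ (λ t≡s → contradiction t≡s t≢s)
                 , (λ pt≡rt → ≡.trans (≡.sym pt≡rt) (≡.sym (lookup∘update′ t≢s p _))) ] (agree t)
    update-agrees : ∀ x t → t ≡ s ⊎ lookup p t ≡ lookup (p [ s ]≔ x) t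
    update-agrees x t = case t ≟ s of λ where
      (yes t≡s) → inj₁ t≡s
      (no t≢s)  → inj₂ (≡.sym (lookup∘update′ t≢s p x))

  -- Each factor rewrites one letter of the current row word, and the empty product left at the end
  -- is the identity matrix, which demands that the final word be q.
  slotProduct-paths : ∀ (B : Fin ν → Fin d → Fin d → Carrier) η p q →
    slotProduct B η p q ≈
    ∑ (words d ν) λ x → when (final η x p ≟ʷ q) (∏ (allFin ν) λ m → B m (incoming η x p m) (lookup x m))
  slotProduct-paths {zero} B [] p q = sym (+-identityʳ _)
  slotProduct-paths {suc ν} B (s ∷ η) p q = begin
    slotProduct B (s ∷ η) p q
      ≡⟨ cong (λ X → X p q) (slotProduct-suc B s η) ⟩
    ((B zero at s) T.* slotProduct (B ∘ suc) η) p q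
      ≈⟨ at-* (B zero) s (slotProduct (B ∘ suc) η) p q ⟩
    ∑ (allFin d) (λ x → B zero (lookup p s) x * slotProduct (B ∘ suc) η (p [ s ]≔ x) q)
      ≈⟨ ∑-cong (allFin d) (λ x → trans (*-congˡ (slotProduct-paths (B ∘ suc) η (p [ s ]≔ x) q))
           (trans (*-∑ (words d ν) _ _) (∑-cong (words d ν) λ xs →
             trans (*-when (final η xs (p [ s ]≔ x) ≟ʷ q))
               (when-cong (final η xs (p [ s ]≔ x) ≟ʷ q) λ _ →
                 sym (∏-allFin λ m → B m (incoming (s ∷ η) (x ∷ xs) p m) (lookup (x ∷ xs) m)))))) ⟩
    ∑ (allFin d) (λ x → ∑ (words d ν) λ xs → F (x ∷ xs))
      ≈⟨ ∑-words d ν F ⟨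
    ∑ (words d (suc ν)) F ∎
    where
    F : Word d (suc ν) → Carrier
    F x = when (final (s ∷ η) x p ≟ʷ q) (∏ (allFin (suc ν)) λ m → B m (incoming (s ∷ η) x p m) (lookup x m))

-- Neighbours in sorted lists and the action of a cycle

data Adjacent {A : Set a} : List A → A → A → Set a where
  at-head : ∀ {x y xs} → Adjacent (x ∷ y ∷ xs) x y
  in-tail : ∀ {z xs x y} → Adjacent xs x y → Adjacent (z ∷ xs) x y

∈-head : ∀ {xs : List A} {x} → head xs ≡ just x → x ∈ xs
∈-head {xs = _ ∷ _} ≡.refl = here ≡.refl

∈-last : ∀ {xs : List A} {x} → last xs ≡ just x → x ∈ xs
∈-last {xs = x ∷ []}     ≡.refl = here ≡.refl
∈-last {xs = _ ∷ _ ∷ xs} eq     = there (∈-last eq)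

last-∷ : ∀ x (xs : List A) → ∃ λ y → last (x ∷ xs) ≡ just y
last-∷ x []       = x , ≡.refl
last-∷ x (y ∷ xs) = last-∷ y xs

nonempty-last : ∀ {xs : List A} {x} → x ∈ xs → ∃ λ y → last xs ≡ just y
nonempty-last {xs = x ∷ xs} _ = last-∷ x xs

head-or-adjacent : ∀ {xs : List A} {x} → x ∈ xs → head xs ≡ just x ⊎ ∃ λ w → Adjacent xs w x
head-or-adjacent (here ≡.refl) = inj₁ ≡.refl
head-or-adjacent {xs = _ ∷ _ ∷ _} (there x∈xs) with head-or-adjacent x∈xs
... | inj₁ ≡.refl    = inj₂ (_ , at-head)
... | inj₂ (_ , adj) = inj₂ (_ , in-tail adj)

last-or-adjacent : ∀ {xs : List A} {x} → x ∈ xs → last xs ≡ just x ⊎ ∃ λ y → Adjacent xs x y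
last-or-adjacent {xs = _ ∷ []}    (here ≡.refl) = inj₁ ≡.refl
last-or-adjacent {xs = _ ∷ _ ∷ _} (here ≡.refl) = inj₂ (_ , at-head)
last-or-adjacent {xs = _ ∷ _ ∷ _} (there x∈xs) with last-or-adjacent x∈xs
... | inj₁ eq        = inj₁ eq
... | inj₂ (_ , adj) = inj₂ (_ , in-tail adj)

adjacent-∈ˡ : ∀ {xs : List A} {x y} → Adjacent xs x y → x ∈ xs
adjacent-∈ˡ at-head        = here ≡.refl
adjacent-∈ˡ (in-tail adj) = there (adjacent-∈ˡ adj)

adjacent-∈ʳ : ∀ {xs : List A} {x y} → Adjacent xs x y → y ∈ xs
adjacent-∈ʳ at-head        = there (here ≡.refl)
adjacent-∈ʳ (in-tail adj) = there (adjacent-∈ʳ adj)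

Sorted : List (Fin ν) → Set
Sorted = AllPairsᴸ.AllPairs Fin._<_

head-least : ∀ {xs : List (Fin ν)} {x} → Sorted xs → head xs ≡ just x → ∀ {y} → y ∈ xs → x Fin.≤ y
head-least (_ ∷ _)    ≡.refl (here ≡.refl) = ℕ.≤-refl
head-least (x<xs ∷ _) ≡.refl (there y∈xs)  = ℕ.<⇒≤ (All.lookup x<xs y∈xs)

last-greatest : ∀ {xs : List (Fin ν)} {x} → Sorted xs → last xs ≡ just x → ∀ {y} → y ∈ xs → y Fin.≤ x
last-greatest {xs = _ ∷ []}    _          ≡.refl (here ≡.refl) = ℕ.≤-refl
last-greatest {xs = _ ∷ _ ∷ _} (x<xs ∷ _) eq     (here ≡.refl) = ℕ.<⇒≤ (All.lookup x<xs (∈-last eq))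
last-greatest {xs = _ ∷ _ ∷ _} (_ ∷ s)    eq     (there y∈xs)  = last-greatest s eq y∈xs

adjacent-< : ∀ {xs : List (Fin ν)} {x y} → Sorted xs → Adjacent xs x y → x Fin.< y
adjacent-< ((x<y ∷ _) ∷ _) at-head     = x<y
adjacent-< (_ ∷ s)         (in-tail adj) = adjacent-< s adj

adjacent-gap : ∀ {xs : List (Fin ν)} {x y} → Sorted xs → Adjacent xs x y →
               ∀ {z} → z ∈ xs → x Fin.< z → z Fin.< y → A
adjacent-gap s at-head (here ≡.refl)         x<z z<y = contradiction x<z (ℕ.n≮n _)
adjacent-gap s at-head (there (here ≡.refl)) x<z z<y = contradiction z<y (ℕ.n≮n _)
adjacent-gap (_ ∷ y<xs ∷ _) at-head (there (there z∈xs)) x<z z<y =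
  contradiction (All.lookup y<xs z∈xs) (ℕ.<-asym z<y)
adjacent-gap (w<xs ∷ _) (in-tail adj) (here ≡.refl) x<z z<y =
  contradiction (All.lookup w<xs (adjacent-∈ˡ adj)) (ℕ.<-asym x<z)
adjacent-gap (_ ∷ s) (in-tail adj) (there z∈xs) x<z z<y = adjacent-gap s adj z∈xs x<z z<y

cycle-head : ∀ (x y : Fin ν) ys → cycle (x ∷ y ∷ ys) x ≡ y
cycle-head x y ys rewrite dec-true (x ≟ x) ≡.refl = ≡.refl

-- `cycle` remembers its first element as the point to return to. Inductions therefore keep the head
-- and remove the second element.
cycle-skip : ∀ (x y z : Fin ν) zs {t} → t ≢ x → t ≢ y → cycle (x ∷ y ∷ z ∷ zs) t ≡ cycle (x ∷ z ∷ zs) t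
cycle-skip x y z zs {t} t≢x t≢y rewrite dec-false (t ≟ x) t≢x | dec-false (t ≟ y) t≢y = ≡.refl

cycle-fixed : ∀ (xs : List (Fin ν)) {t} → t ∉ xs → cycle xs t ≡ t
cycle-fixed []           t∉ = ≡.refl
cycle-fixed (x ∷ [])     {t} t∉ rewrite dec-false (t ≟ x) (t∉ ∘ here) = ≡.refl
cycle-fixed (x ∷ y ∷ []) {t} t∉
  rewrite dec-false (t ≟ x) (t∉ ∘ here) | dec-false (t ≟ y) (t∉ ∘ there ∘ here) = ≡.refl
cycle-fixed (x ∷ y ∷ z ∷ zs) t∉ = ≡.trans (cycle-skip x y z zs (t∉ ∘ here) (t∉ ∘ there ∘ here))
  (cycle-fixed (x ∷ z ∷ zs) λ { (here t≡x) → t∉ (here t≡x) ; (there t∈) → t∉ (there (there t∈)) })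

cycle-adjacent : ∀ {xs : List (Fin ν)} {t u} → Sorted xs → Adjacent xs t u → cycle xs t ≡ u
cycle-adjacent {xs = x ∷ y ∷ ys} s at-head = cycle-head x y ys
cycle-adjacent {xs = x ∷ y ∷ z ∷ zs} (x<xs@(x<y ∷ _) ∷ _) (in-tail at-head)
  rewrite dec-false (y ≟ x) (≢-sym (Fin.<⇒≢ x<y)) | dec-true (y ≟ y) ≡.refl = ≡.refl
cycle-adjacent {xs = x ∷ y ∷ z ∷ zs} ((_ ∷ x<zs) ∷ y<zs ∷ s) (in-tail (in-tail adj)) =
  ≡.trans (cycle-skip x y z zs
            (≢-sym (Fin.<⇒≢ (All.lookup x<zs (adjacent-∈ˡ adj)))) (≢-sym (Fin.<⇒≢ (All.lookup y<zs (adjacent-∈ˡ adj)))))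
          (cycle-adjacent (x<zs ∷ s) (in-tail adj))

∈-mapMaybe⁻ : ∀ (f : A → Maybe B) xs {y} → y ∈ mapMaybe f xs → ∃ λ x → f x ≡ just y
∈-mapMaybe⁻ f (x ∷ xs) y∈ with f x in eq | y∈
... | nothing | y∈          = ∈-mapMaybe⁻ f xs y∈
... | just _  | here ≡.refl = x , eq
... | just _  | there y∈    = ∈-mapMaybe⁻ f xs y∈

∈-mapMaybe⁺ : ∀ (f : A → Maybe B) {xs x y} → x ∈ xs → f x ≡ just y → y ∈ mapMaybe f xs
∈-mapMaybe⁺ f {x ∷ xs} (here ≡.refl) eq rewrite eq = here ≡.refl
∈-mapMaybe⁺ f {x ∷ xs} (there x∈xs)  eq with f x
... | nothing = ∈-mapMaybe⁺ f x∈xs eq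
... | just _  = there (∈-mapMaybe⁺ f x∈xs eq)

-- Fibres of η, their extreme elements and the permutation γ

module Fibres {n : ℕ} (η : Word n n) where

  allFin-sorted : Sorted (allFin n)
  allFin-sorted = AllPairsᴸ.tabulate⁺-< id

  fibre-sorted : ∀ N → Sorted (fibre η N)
  fibre-sorted N = AllPairsᴸ.filter⁺ (λ i → lookup η i ≟ N) allFin-sorted

  ∈-fibre⁺ : ∀ {N t} → lookup η t ≡ N → t ∈ fibre η N
  ∈-fibre⁺ {N} {t} = ∈-filter⁺ (λ i → lookup η i ≟ N) (∈-allFin t)

  ∈-fibre⁻ : ∀ {N t} → t ∈ fibre η N → lookup η t ≡ N
  ∈-fibre⁻ {N} t∈ = proj₂ (∈-filter⁻ (λ i → lookup η i ≟ N) {xs = allFin n} t∈)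

  ∈-image : ∀ t → lookup η t ∈ image η
  ∈-image t = ∈-filter⁺ (∈Im? η) (∈-allFin (lookup η t)) (t , ≡.refl)

  adjacent⇒next : ∀ {N j t} → Adjacent (fibre η N) j t → Next η j t
  adjacent⇒next {N} {j} {t} adj = next (adjacent-< s adj) (≡.trans ηj≡N (≡.sym ηt≡N))
    λ i j<i i<t ηi≡ηt → adjacent-gap s adj (∈-fibre⁺ (≡.trans ηi≡ηt ηt≡N)) j<i i<t
    where
    s = fibre-sorted N
    ηj≡N = ∈-fibre⁻ (adjacent-∈ˡ adj)
    ηt≡N = ∈-fibre⁻ (adjacent-∈ʳ adj)

  next-injective : ∀ {i j t} → Next η i t → Next η j t → i ≡ j
  next-injective {i} {j} (next i<t ηi≡ b) (next j<t ηj≡ b′) with <-cmp i j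
  ... | tri< i<j _ _ = contradiction ηj≡ (b j i<j j<t)
  ... | tri≈ _ i≡j _ = i≡j
  ... | tri> _ _ j<i = contradiction ηi≡ (b′ i j<i i<t)

  ∈-G⁻⇒first : ∀ {t} → t ∈ G⁻ η → IsFirst η t
  ∈-G⁻⇒first t∈ j j<t ηj≡ηt with N , eq ← ∈-mapMaybe⁻ (head ∘ fibre η) (image η) t∈ =
    ℕ.<⇒≱ j<t (head-least (fibre-sorted N) eq (∈-fibre⁺ (≡.trans ηj≡ηt (∈-fibre⁻ (∈-head eq)))))

  ∈-G⁺⇒last : ∀ {t} → t ∈ G⁺ η → IsLast η t
  ∈-G⁺⇒last t∈ j t<j ηj≡ηt with N , eq ← ∈-mapMaybe⁻ (last ∘ fibre η) (image η) t∈ =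
    ℕ.<⇒≱ t<j (last-greatest (fibre-sorted N) eq (∈-fibre⁺ (≡.trans ηj≡ηt (∈-fibre⁻ (∈-last eq)))))

  first-or-next : ∀ t → t ∈ G⁻ η ⊎ ∃ λ j → Next η j t
  first-or-next t = Sum.map (∈-mapMaybe⁺ (head ∘ fibre η) (∈-image t)) (λ (j , adj) → j , adjacent⇒next adj)
    (head-or-adjacent (∈-fibre⁺ {t = t} ≡.refl))

  last-or-adjacent-fibre : ∀ t → t ∈ G⁺ η ⊎ ∃ λ u → Adjacent (fibre η (lookup η t)) t u
  last-or-adjacent-fibre t = Sum.map₁ (∈-mapMaybe⁺ (last ∘ fibre η) (∈-image t))
    (last-or-adjacent (∈-fibre⁺ {t = t} ≡.refl))

  last-in-fibre : ∀ t → ∃ λ u → u ∈ G⁺ η × lookup η u ≡ lookup η t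
  last-in-fibre t = let u , eq = nonempty-last (∈-fibre⁺ {t = t} ≡.refl) in
    u , ∈-mapMaybe⁺ (last ∘ fibre η) (∈-image t) eq , ∈-fibre⁻ (∈-last eq)

  next⇒∉G⁻ : ∀ {j t} → Next η j t → t ∉ G⁻ η
  next⇒∉G⁻ (next j<t ηj≡ηt _) t∈ = ∈-G⁻⇒first t∈ _ j<t ηj≡ηt

  next⇒∉G⁺ : ∀ {j t} → Next η j t → j ∉ G⁺ η
  next⇒∉G⁺ (next j<t ηj≡ηt _) j∈ = ∈-G⁺⇒last j∈ _ j<t (≡.sym ηj≡ηt)

  private
    cycles : List (Fin n) → Fin n → Fin n
    cycles Ns = foldr _∘_ id (map (λ N → cycle (fibre η N)) Ns)

    cycles-∉ : ∀ Ns {t} → lookup η t ∉ Ns → cycles Ns t ≡ t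
    cycles-∉ []       ηt∉ = ≡.refl
    cycles-∉ (N ∷ Ns) ηt∉ = ≡.trans (cong (cycle (fibre η N)) (cycles-∉ Ns (ηt∉ ∘ there)))
      (cycle-fixed (fibre η N) (ηt∉ ∘ here ∘ ∈-fibre⁻))

    -- The fibres are disjoint: cycles applied before that of the fibre of t fix t, and cycles
    -- applied after it fix u, which lies in the same fibre.
    cycles-adjacent : ∀ {Ns t u} → Sorted Ns → lookup η t ∈ Ns → Adjacent (fibre η (lookup η t)) t u → cycles Ns t ≡ u
    cycles-adjacent {N ∷ Ns} (N<Ns ∷ _) (here ≡.refl) adj =
      ≡.trans (cong (cycle (fibre η N)) (cycles-∉ Ns λ N∈Ns → ℕ.n≮n _ (All.lookup N<Ns N∈Ns)))
              (cycle-adjacent (fibre-sorted N) adj)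
    cycles-adjacent {N ∷ Ns} (N<Ns ∷ s) (there ηt∈) adj =
      ≡.trans (cong (cycle (fibre η N)) (cycles-adjacent s ηt∈ adj))
        (cycle-fixed (fibre η N) λ u∈ → ℕ.n≮n _ (subst (N Fin.<_)
          (≡.trans (≡.sym (∈-fibre⁻ (adjacent-∈ʳ adj))) (∈-fibre⁻ u∈)) (All.lookup N<Ns ηt∈)))

  γ-adjacent : ∀ {t u} → Adjacent (fibre η (lookup η t)) t u → γ η t ≡ u
  γ-adjacent {t} = cycles-adjacent (AllPairsᴸ.filter⁺ (∈Im? η) allFin-sorted) (∈-image t)

  γ-next : ∀ {j t} → Next η j t → γ η j ≡ t
  γ-next {j} {t} nx@(next j<t ηj≡ηt b) with last-or-adjacent-fibre j
  ... | inj₁ j∈G⁺ = contradiction j∈G⁺ (next⇒∉G⁺ nx)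
  ... | inj₂ (u , adj) with next j<u ηj≡ηu b′ ← adjacent⇒next adj | <-cmp u t
  ...   | tri< u<t _ _ = contradiction (≡.trans (≡.sym ηj≡ηu) ηj≡ηt) (b u j<u u<t)
  ...   | tri≈ _ u≡t _ = ≡.trans (γ-adjacent adj) u≡t
  ...   | tri> _ _ t<u = contradiction (≡.trans (≡.sym ηj≡ηt) ηj≡ηu) (b′ t j<t t<u)

-- Matrix coefficients as sums over the Einstein variables

module Coefficients (𝓡 : Ring c ℓ) (n : ℕ) (B : Fin n → Fin n → Fin n → Ring.Carrier 𝓡) (η σ : Word n n) where
  open Ring 𝓡 hiding (zero)
  open BigOps rawRing
  open FiniteSums 𝓡
  open import Relation.Binary.Reasoning.Setoid setoid
  open SlotProducts 𝓡 n n
  open Paths 𝓡 n n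
  open Fibres η

  low up : Word n n → Fin n → Fin n
  low s m = if does (m ∈? G⁻ η) then lookup σ (lookup η m) else lookup s m
  up  s m = if does (m ∈? G⁺ η) then lookup η m else lookup s (γ η m)

  -- What factor m writes is its column index. Unless m closes its fibre, this is the variable
  -- shared with the next factor γ(m), so s_t is recovered as the letter written by the predecessor
  -- of t. A first element t has no predecessor and receives the placeholder t prescribed by
  -- `assignments`.
  toPath fromPath : Word n n → Word n n
  toPath s = Vec.tabulate (up s)
  fromPath x = Vec.tabulate λ t → [ (λ _ → t) , (λ (j , _) → lookup x j) ] (first-or-next t)

  toPath-last : ∀ s {m} → m ∈ G⁺ η → lookup (toPath s) m ≡ lookup η m
  toPath-last s {m} m∈ = ≡.trans (lookup∘tabulate (up s) m)
    (cong (if_then lookup η m else lookup s (γ η m)) (dec-true (m ∈? G⁺ η) m∈))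

  toPath-next : ∀ s {m t} → Next η m t → lookup (toPath s) m ≡ lookup s t
  toPath-next s {m} nx = ≡.trans (lookup∘tabulate (up s) m)
    (≡.trans (cong (if_then lookup η m else lookup s (γ η m)) (dec-false (m ∈? G⁺ η) (next⇒∉G⁺ nx)))
             (cong (lookup s) (γ-next nx)))

  fromPath-first : ∀ x {t} → t ∈ G⁻ η → lookup (fromPath x) t ≡ t
  fromPath-first x {t} t∈ = ≡.trans (lookup∘tabulate _ t) (eq (first-or-next t))
    where
    eq : ∀ alt → [ (λ _ → t) , (λ (j , _) → lookup x j) ] alt ≡ t
    eq (inj₁ _)        = ≡.refl
    eq (inj₂ (_ , nx)) = contradiction t∈ (next⇒∉G⁻ nx)

  fromPath-next : ∀ x {m t} → Next η m t → lookup (fromPath x) t ≡ lookup x m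
  fromPath-next x {m} {t} nx = ≡.trans (lookup∘tabulate _ t) (eq (first-or-next t))
    where
    eq : ∀ alt → [ (λ _ → t) , (λ (j , _) → lookup x j) ] alt ≡ lookup x m
    eq (inj₁ t∈)        = contradiction t∈ (next⇒∉G⁻ nx)
    eq (inj₂ (_ , nx′)) = cong (lookup x) (next-injective nx′ nx)

  incoming-toPath : ∀ s m → incoming η (toPath s) σ m ≡ low s m
  incoming-toPath s m with first-or-next m
  ... | inj₁ m∈ = ≡.trans (incoming-first η (toPath s) σ (∈-G⁻⇒first m∈))
    (≡.sym (cong (if_then lookup σ (lookup η m) else lookup s m) (dec-true (m ∈? G⁻ η) m∈)))
  ... | inj₂ (j , nx) = ≡.trans (≡.trans (incoming-next η (toPath s) σ nx) (toPath-next s nx))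
    (≡.sym (cong (if_then lookup σ (lookup η m) else lookup s m) (dec-false (m ∈? G⁻ η) (next⇒∉G⁻ nx))))

  -- The end condition on a path forces the last factor of each fibre to write the number of its
  -- slot, which is the value η(k) on G⁺; all other letters are free. Slots outside the image keep
  -- the letter of σ, and there the end condition is the assumption that σ fixes them.
  coefficient : (∀ i → ∃ (λ m → lookup η m ≡ i) ⊎ lookup σ i ≡ i) →
    slotProduct B η σ (idʷ n) ≈ ∑ (assignments η) λ s → ∏ (allFin n) λ m → B m (low s m) (up s m)
  coefficient fixes = begin
    slotProduct B η σ (idʷ n)
      ≈⟨ slotProduct-paths B η σ (idʷ n) ⟩
    ∑ (words n n) (λ x → when (final η x σ ≟ʷ idʷ n) (f x))
      ≈⟨ reindex (enumerates-words n n) (enumerates-words n n) pinned? (λ x → final η x σ ≟ʷ idʷ n)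
           toPath fromPath (λ s pinned → final-toPath s , from-to s pinned)
           (λ x fin → (λ t → fromPath-first x) , to-from x fin) f ⟨
    ∑ (words n n) (λ s → when (pinned? s) (f (toPath s)))
      ≈⟨ ∑-cong (words n n) (λ s → when-cong (pinned? s) λ _ → ∏-cong (allFin n) λ m →
           reflexive (cong₂ (B m) (incoming-toPath s m) (lookup∘tabulate (up s) m))) ⟩
    ∑ (words n n) (λ s → when (pinned? s) (∏ (allFin n) λ m → B m (low s m) (up s m)))
      ≈⟨ ∑-filter pinned? (words n n) (λ s → ∏ (allFin n) λ m → B m (low s m) (up s m)) ⟨
    ∑ (assignments η) (λ s → ∏ (allFin n) λ m → B m (low s m) (up s m)) ∎
    where
    f : Word n n → Carrier
    f x = ∏ (allFin n) λ m → B m (incoming η x σ m) (lookup x m)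
    pinned? : ∀ s → Dec (∀ t → t ∈ G⁻ η → lookup s t ≡ t)
    pinned? s = all? λ t → (t ∈? G⁻ η) →-dec (lookup s t ≟ t)

    final-toPath : ∀ s → final η (toPath s) σ ≡ idʷ n
    final-toPath s = lookup-ext λ N → ≡.trans (at N) (≡.sym (lookup-allFin N))
      where
      at : ∀ N → lookup (final η (toPath s) σ) N ≡ N
      at N with ∈Im? η N
      ... | yes (m , ≡.refl) with u , u∈ , eq ← last-in-fibre m = subst (λ N → lookup (final η (toPath s) σ) N ≡ N) eq
              (≡.trans (final-last η (toPath s) σ (∈-G⁺⇒last u∈)) (toPath-last s u∈))
      ... | no ∉Im = ≡.trans (final-∉ η (toPath s) σ λ m eq → ∉Im (m , eq))
              ([ (λ ∈Im → contradiction ∈Im ∉Im) , id ] (fixes N))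

    from-to : ∀ s → (∀ t → t ∈ G⁻ η → lookup s t ≡ t) → s ≡ fromPath (toPath s)
    from-to s pinned = lookup-ext λ t → case first-or-next t of λ where
      (inj₁ t∈)       → ≡.trans (pinned t t∈) (≡.sym (fromPath-first (toPath s) t∈))
      (inj₂ (j , nx)) → ≡.sym (≡.trans (fromPath-next (toPath s) nx) (toPath-next s nx))

    to-from : ∀ x → final η x σ ≡ idʷ n → x ≡ toPath (fromPath x)
    to-from x fin = lookup-ext λ m → case last-or-adjacent-fibre m of λ where
      (inj₁ m∈) → ≡.trans (≡.sym (final-last η x σ (∈-G⁺⇒last m∈)))
        (≡.trans (cong (λ w → lookup w (lookup η m)) fin)
          (≡.trans (lookup-allFin (lookup η m)) (≡.sym (toPath-last (fromPath x) m∈))))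
      (inj₂ (u , adj)) → let nx = adjacent⇒next adj in
        ≡.sym (≡.trans (toPath-next (fromPath x) nx) (fromPath-next x nx))

theorem1 : ∀ {c ℓ₁ ℓ₂ : Level} (K : HeytingField c ℓ₁ ℓ₂) (char0 : CharacteristicZero K) (m l : ℕ) →
    let open Reflection K char0 m l in
    (∀ (sdet : 𝓢) → IsSdet sdet →
    sdet ≋ (∑[ η ∈ I n ] ∑[ σ ∈ S η ] (α σ η * coeff η σ (idʷ n))))
    × (∀ (η σ : Word n n) → η ∈ I n → σ ∈ S η →
    coeff η σ (idʷ n) ≋ (∑[ s ∈ assignments η ] ∏[ k ∈ allFin n ] B[ k ] (lower σ η s k) (upper σ η s k)))
theorem1 K char0 m l =
    -- With h = ½ the term `recip ½-central k` unfolds to `1/[2u- k ]`, so the abstract bracket and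
    -- weights become the defined ones by computation.
    SdetFormula.sdet-formula powerSeriesRing n (recip ½-central) (central-recip ½-central) (recip-suc ½-central) B[_]
  , λ η σ _ σ∈S → Coefficients.coefficient powerSeriesRing n B[_] η σ
      (proj₂ (∈-filter⁻ (λ σ → all? λ i → ∈Im? η i ⊎-dec (lookup σ i ≟ i)) {xs = permutations n} σ∈S))
  where
  open Reflection K char0 m l
  open PowerSeriesRing 𝓑
  ½-central : Central 𝓑 ½
  ½-central s = ι-central _ s
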